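{- Syntactic boundedness of timed Petri nets is decidable: there is an algorithm which, given a timed Petri net $N$ with an initial marking $M_0$, decides whether $\max\{|M'| : M'\in\mathit{Reach}(M_0)\}$ is bounded, i.e., whether there is a finite constant $c$ such that $|M'|\le c$ for every marking $M'$ reachable from $M_0$.
   Context: **Timed Petri nets.** $\mathbb N$ contains $0$. An interval has a lower bound in $\mathbb N$ and an upper bound in $\mathbb N\cup\{\infty\}$, and may be open, closed or half-open. A timed Petri net (TPN) is a tuple $N=(P,T,\mathit{In},\mathit{Out})$ with finite sets $P$ (places), $T$ (transitions) and partial functions $\mathit{In},\mathit{Out}$ from $T\times P$ to intervals; $p$ is an input (output) place of $t$ if $\mathit{In}(t,p)$ ($\mathit{Out}(t,p)$) is defined. A marking is a finite multiset over $P\times\mathbb R^{\ge 0}$; an element $(p,x)$ is a token of age $x$ in place $p$, and $|M|$ is the number of tokens of $M$ (counted with multiplicity). The relation $\le$ and the operations $+,-$ on multisets are pointwise. Timed transition: for real $x>0$, $M_1\to_x M_2$ if $M_2$ is obtained from $M_1$ by increasing the age of every token by $x$. Discrete transition: $M_1\to_t M_2$ if there are multisets $b_1\le M_1$ and $b_2$, where $b_1$ consists of exactly one token $(p,x)$ with $x\in\mathit{In}(t,p)$ for each input place $p$ of $t$, $b_2$ consists of exactly one token $(q,y)$ with $y\in\mathit{Out}(t,q)$ for each output place $q$ of $t$, and $M_2=(M_1-b_1)+b_2$. Let $\to$ be the union of all timed and discrete transition relations, and $\mathit{Reach}(M_0)=\{M'\mid M_0\to^*M'\}$. **Input convention.**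 Input markings are given finitely, with rational token ages. -}

module Defs where

open import Data.Fin.Base using (Fin)
open import Data.Integer.Base as ℤ using (+_; -[1+_])
import Data.Integer.Properties as ℤ
open import Data.List.Base using (List; _++_; map; mapMaybe; length; allFin)
open import Data.List.Relation.Binary.Pointwise using (Pointwise)
open import Data.Maybe.Base as Maybe using (Maybe)
open import Data.Nat.Base as ℕ using (ℕ; suc)
import Data.Nat.Properties as ℕ
open import Data.Nat.Tactic.RingSolver using (solve-∀)
open import Data.Product.Base using (Σ; ∃-syntax; _×_; _,_; proj₁; proj₂; swap)
open import Data.Product.Relation.Binary.Pointwise.NonDependent using (_×ₛ_)
open import Data.Rational.Base as ℚ using (ℚ; mkℚ; 0ℚ)
import Data.Rational.Properties as ℚ
open import Data.Rational.Solver using (module +-*-Solver)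
open import Data.Rational.Unnormalised.Base as ℚᵘ using (mkℚᵘ)
import Data.Rational.Unnormalised.Properties as ℚᵘ
open import Data.Sum.Base using (_⊎_)
open import Data.Unit.Base using (⊤)
open import Level using (0ℓ)
open import Relation.Binary.Bundles using (Setoid)
open import Relation.Binary.Construct.Closure.ReflexiveTransitive using (Star)
import Relation.Binary.Construct.On as On
open import Relation.Binary.PropositionalEquality as ≡ using (_≡_; refl; cong; subst)
open import Relation.Nullary using (yes; no; contradiction)
import Data.List.Relation.Binary.Permutation.Setoid as Permutation

------------------------------------------------------------------------
-- Precisions 1/(n+1)

δ : ℕ → ℚ
δ n = + 1 ℚ./ suc n

half : ℕ → ℕ
half n = suc (n ℕ.+ n)

δ-half : ∀ n → δ (half n) ℚ.+ δ (half n) ≡ δ n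
δ-half n = ℚ.toℚᵘ-injective (begin
  ℚ.toℚᵘ (δ (half n) ℚ.+ δ (half n))
    ≈⟨ ℚ.toℚᵘ-homo-+ (δ (half n)) (δ (half n)) ⟩
  ℚ.toℚᵘ (δ (half n)) ℚᵘ.+ ℚ.toℚᵘ (δ (half n))
    ≈⟨ ℚᵘ.+-cong to-from to-from ⟩
  mkℚᵘ (+ 1) (half n) ℚᵘ.+ mkℚᵘ (+ 1) (half n)
    ≈⟨ ℚᵘ.*≡* (cong +_ (cross n)) ⟩
  mkℚᵘ (+ 1) n
    ≈⟨ ℚᵘ.≃-sym (ℚ.toℚᵘ-fromℚᵘ (mkℚᵘ (+ 1) n)) ⟩
  ℚ.toℚᵘ (δ n) ∎)
  where
  open ℚᵘ.≃-Reasoning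
  to-from = ℚ.toℚᵘ-fromℚᵘ (mkℚᵘ (+ 1) (half n))
  cross : ∀ n →
    (1 ℕ.* suc (suc (n ℕ.+ n)) ℕ.+ 1 ℕ.* suc (suc (n ℕ.+ n))) ℕ.* suc n
      ≡ 1 ℕ.* (suc (suc (n ℕ.+ n)) ℕ.* suc (suc (n ℕ.+ n)))
  cross = solve-∀

δ-archimedean : ∀ ε → 0ℚ ℚ.< ε → ∃[ k ] δ k ℚ.< ε
δ-archimedean (mkℚ (+ 0)      d c) (ℚ.*<* (ℤ.+<+ ()))
δ-archimedean (mkℚ -[1+ a ]   d c) (ℚ.*<* ())
δ-archimedean (mkℚ (+ suc a)  d c) _ =
  suc d , ℚ.toℚᵘ-cancel-< (ℚᵘ.<-respˡ-≃ (ℚᵘ.≃-sym (ℚ.toℚᵘ-fromℚᵘ (mkℚᵘ (+ 1) (suc d))))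
    (ℚᵘ.*<* (ℤ.+<+ (begin-strict
      1 ℕ.* suc d             ≡⟨ ℕ.*-identityˡ (suc d) ⟩
      suc d                   <⟨ ℕ.n<1+n (suc d) ⟩
      suc (suc d)             ≤⟨ ℕ.m≤m+n _ _ ⟩
      suc a ℕ.* suc (suc d)   ∎))))
  where open ℕ.≤-Reasoning

≤-limit : ∀ {p q} → (∀ k → p ℚ.≤ q ℚ.+ δ k) → p ℚ.≤ q
≤-limit {p} {q} h with p ℚ.≤? q
... | yes p≤q = p≤q
... | no  p≰q = contradiction (ℚ.≤-<-trans (h k) (subst (q ℚ.+ δ k ℚ.<_) cancel (ℚ.+-monoʳ-< q δk<))) (ℚ.<-irrefl refl)
  where
  open +-*-Solver
  cancel : q ℚ.+ (p ℚ.- q) ≡ p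
  cancel = solve 2 (λ q p → q :+ (p :- q) := p) refl q p
  gap = δ-archimedean (p ℚ.- q)
          (subst (ℚ._< p ℚ.- q) (ℚ.+-inverseʳ q) (ℚ.+-monoˡ-< (ℚ.- q) (ℚ.≰⇒> p≰q)))
  k   = proj₁ gap
  δk< = proj₂ gap

------------------------------------------------------------------------
-- Real numbers, as regular Cauchy sequences of rationals (Bishop)

-- Swapping m and n, regularity says |x m − x n| ≤ δ m + δ n; the
-- sequence represents a real lying in [x n − δ n , x n + δ n] for all n.
record ℝ : Set where
  field
    approx  : ℕ → ℚ
    regular : ∀ m n → approx m ℚ.≤ approx n ℚ.+ (δ m ℚ.+ δ n)

open ℝ public

infix 4 _≤_ _<_ _≃_

-- Every lower estimate of x is at most every upper estimate of y.
_≤_ : ℝ → ℝ → Set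
x ≤ y = ∀ m n → approx x m ℚ.≤ approx y n ℚ.+ (δ m ℚ.+ δ n)

-- Some upper estimate of x is below some lower estimate of y.
_<_ : ℝ → ℝ → Set
x < y = ∃[ m ] ∃[ n ] approx x m ℚ.+ (δ m ℚ.+ δ n) ℚ.< approx y n

-- Equality of reals; ℝ itself is the type of representing sequences.
_≃_ : ℝ → ℝ → Set
x ≃ y = x ≤ y × y ≤ x

≤-refl : ∀ {x} → x ≤ x
≤-refl {x} = regular x

≤-trans : ∀ {x y z} → x ≤ y → y ≤ z → x ≤ z
≤-trans {x} {y} {z} x≤y y≤z m n = ≤-limit λ k → begin
  approx x m
    ≤⟨ x≤y m (half k) ⟩
  approx y (half k) ℚ.+ (δ m ℚ.+ δ (half k))
    ≤⟨ ℚ.+-monoˡ-≤ _ (y≤z (half k) n) ⟩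
  approx z n ℚ.+ (δ (half k) ℚ.+ δ n) ℚ.+ (δ m ℚ.+ δ (half k))
    ≡⟨ regroup (approx z n) (δ m) (δ n) (δ (half k)) ⟩
  approx z n ℚ.+ (δ m ℚ.+ δ n) ℚ.+ (δ (half k) ℚ.+ δ (half k))
    ≡⟨ cong (approx z n ℚ.+ (δ m ℚ.+ δ n) ℚ.+_) (δ-half k) ⟩
  approx z n ℚ.+ (δ m ℚ.+ δ n) ℚ.+ δ k ∎
  where
  open ℚ.≤-Reasoning
  regroup : ∀ a m n h → a ℚ.+ (h ℚ.+ n) ℚ.+ (m ℚ.+ h) ≡ a ℚ.+ (m ℚ.+ n) ℚ.+ (h ℚ.+ h)
  regroup = solve 4 (λ a m n h → a :+ (h :+ n) :+ (m :+ h) := a :+ (m :+ n) :+ (h :+ h)) refl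
    where open +-*-Solver

ℝ-setoid : Setoid 0ℓ 0ℓ
ℝ-setoid = record
  { Carrier       = ℝ
  ; _≈_           = _≃_
  ; isEquivalence = record
    { refl  = λ {x} → ≤-refl {x} , ≤-refl {x}
    ; sym   = swap
    ; trans = λ {x} {y} {z} (x≤y , y≤x) (y≤z , z≤y) →
        ≤-trans {x} {y} {z} x≤y y≤z , ≤-trans {z} {y} {x} z≤y y≤x
    }
  }

fromℚ : ℚ → ℝ
fromℚ q .approx  _   = q
fromℚ q .regular m n = subst (ℚ._≤ q ℚ.+ (δ m ℚ.+ δ n)) (ℚ.+-identityʳ q)
  (ℚ.+-monoʳ-≤ q (ℚ.+-mono-≤ (0≤δ m) (0≤δ n)))
  where
  0≤δ : ∀ n → 0ℚ ℚ.≤ δ n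
  0≤δ n = ℚ.nonNegative⁻¹ (δ n) {{ℚ.normalize-nonNeg 1 (suc n)}}

fromℕ : ℕ → ℝ
fromℕ n = fromℚ (+ n ℚ./ 1)

0ℝ : ℝ
0ℝ = fromℚ 0ℚ

sum-≤ : ∀ a b c d m n →
  a ℚ.≤ b ℚ.+ (δ (half m) ℚ.+ δ (half n)) →
  c ℚ.≤ d ℚ.+ (δ (half m) ℚ.+ δ (half n)) →
  a ℚ.+ c ℚ.≤ b ℚ.+ d ℚ.+ (δ m ℚ.+ δ n)
sum-≤ a b c d m n a≤b c≤d = begin
  a ℚ.+ c
    ≤⟨ ℚ.+-mono-≤ a≤b c≤d ⟩
  (b ℚ.+ (δ m′ ℚ.+ δ n′)) ℚ.+ (d ℚ.+ (δ m′ ℚ.+ δ n′))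
    ≡⟨ regroup b d (δ m′) (δ n′) ⟩
  b ℚ.+ d ℚ.+ ((δ m′ ℚ.+ δ m′) ℚ.+ (δ n′ ℚ.+ δ n′))
    ≡⟨ ≡.cong₂ (λ u v → b ℚ.+ d ℚ.+ (u ℚ.+ v)) (δ-half m) (δ-half n) ⟩
  b ℚ.+ d ℚ.+ (δ m ℚ.+ δ n) ∎
  where
  open ℚ.≤-Reasoning
  m′ = half m
  n′ = half n
  regroup : ∀ b d m n →
    (b ℚ.+ (m ℚ.+ n)) ℚ.+ (d ℚ.+ (m ℚ.+ n)) ≡ b ℚ.+ d ℚ.+ ((m ℚ.+ m) ℚ.+ (n ℚ.+ n))
  regroup = solve 4 (λ b d m n →
    (b :+ (m :+ n)) :+ (d :+ (m :+ n)) := b :+ d :+ ((m :+ m) :+ (n :+ n))) refl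
    where open +-*-Solver

infixl 6 _+_

-- Termwise addition doubles the error, hence the finer index
-- half n = 2n+1, for which δ (half n) is half of δ n.
_+_ : ℝ → ℝ → ℝ
(x + y) .approx  n   = approx x (half n) ℚ.+ approx y (half n)
(x + y) .regular m n =
  sum-≤ (approx x (half m)) (approx x (half n)) (approx y (half m)) (approx y (half n)) m n
    (regular x (half m) (half n)) (regular y (half m) (half n))

0≤+ : ∀ {x y} → 0ℝ ≤ x → 0ℝ ≤ y → 0ℝ ≤ x + y
0≤+ {x} {y} 0≤x 0≤y m n =
  sum-≤ 0ℚ (approx x (half n)) 0ℚ (approx y (half n)) m n
    (0≤x (half m) (half n)) (0≤y (half m) (half n))

record ℝ≥0 : Set where
  constructor _,_
  field
    value       : ℝ
    nonNegative : 0ℝ ≤ value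

open ℝ≥0 public

ℝ≥0-setoid : Setoid 0ℓ 0ℓ
ℝ≥0-setoid = On.setoid ℝ-setoid value

infixl 6 _⊕_

_⊕_ : ℝ≥0 → ℝ≥0 → ℝ≥0
(x , 0≤x) ⊕ (y , 0≤y) = x + y , 0≤+ {x} {y} 0≤x 0≤y

ℚ≥0 : Set
ℚ≥0 = Σ ℚ (0ℚ ℚ.≤_)

fromℚ≥0 : ℚ≥0 → ℝ≥0
fromℚ≥0 (q , 0≤q) = fromℚ q , λ m n → ℚ.≤-trans 0≤q (regular (fromℚ q) m n)

------------------------------------------------------------------------
-- Intervals

data LowerBound : Set where
  closed strict : ℕ → LowerBound

data UpperBound : Set where
  closed strict : ℕ → UpperBound
  ∞             : UpperBound

-- Bounds are not required to be ordered, so an interval may be empty.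
record Interval : Set where
  field
    lower : LowerBound
    upper : UpperBound

_∈ˡ_ : ℝ → LowerBound → Set
x ∈ˡ closed a = fromℕ a ≤ x
x ∈ˡ strict a = fromℕ a < x

_∈ᵘ_ : ℝ → UpperBound → Set
x ∈ᵘ closed b = x ≤ fromℕ b
x ∈ᵘ strict b = x < fromℕ b
x ∈ᵘ ∞        = ⊤

_∈ᴵ_ : ℝ≥0 → Interval → Set
x ∈ᴵ I = value x ∈ˡ Interval.lower I × value x ∈ᵘ Interval.upper I

------------------------------------------------------------------------
-- Timed Petri nets

record TPN : Set where
  field
    #places      : ℕ
    #transitions : ℕ

  Place      = Fin #places
  Transition = Fin #transitions

  field
    In  : Transition → Place → Maybe Interval
    Out : Transition → Place → Maybe Interval

module _ (N : TPN) where
  open TPN N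

  Token : Set
  Token = Place × ℝ≥0

  Token-setoid : Setoid 0ℓ 0ℓ
  Token-setoid = ≡.setoid Place ×ₛ ℝ≥0-setoid

  -- A finite multiset is a list, considered up to _↭_: permutation and
  -- equality of ages as real numbers. Steps respect _↭_, as does ∣_∣.
  Marking : Set
  Marking = List Token

  open Permutation Token-setoid using (_↭_)

  ∣_∣ : Marking → ℕ
  ∣ M ∣ = length M

  ageBy : ℝ≥0 → Marking → Marking
  ageBy d = map (λ (p , x) → p , x ⊕ d)

  TimedStep : ℝ≥0 → Marking → Marking → Set
  TimedStep d M₁ M₂ = M₂ ↭ ageBy d M₁

  -- The places on which a partial function is defined, with its values.
  arcs : (Place → Maybe Interval) → List (Place × Interval)
  arcs f = mapMaybe (λ p → Maybe.map (p ,_) (f p)) (allFin #places)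

  OneTokenPerArc : (Place → Maybe Interval) → Marking → Set
  OneTokenPerArc f = Pointwise (λ (p , I) (q , x) → p ≡ q × x ∈ᴵ I) (arcs f)

  -- The marking rest is M₁ − b₁; its existence expresses b₁ ≤ M₁, since
  -- pointwise subtraction is not computable for undecidable age equality.
  DiscreteStep : Transition → Marking → Marking → Set
  DiscreteStep t M₁ M₂ = ∃[ b₁ ] ∃[ b₂ ] ∃[ rest ]
      OneTokenPerArc (In t) b₁
    × OneTokenPerArc (Out t) b₂
    × M₁ ↭ b₁ ++ rest
    × M₂ ↭ rest ++ b₂

  Step : Marking → Marking → Set
  Step M₁ M₂ =
      (∃[ d ] 0ℝ < value d × TimedStep d M₁ M₂)
    ⊎ (∃[ t ] DiscreteStep t M₁ M₂)

  Reach : Marking → Marking → Set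
  Reach = Star Step

  SyntacticallyBounded : Marking → Set
  SyntacticallyBounded M₀ = ∃[ c ] (∀ M′ → Reach M₀ M′ → ∣ M′ ∣ ℕ.≤ c)

  RationalMarking : Set
  RationalMarking = List (Place × ℚ≥0)

  fromRational : RationalMarking → Marking
  fromRational = map (λ (p , q) → p , fromℚ≥0 q)

module Submission where

-- The argument abstracts markings to regions and runs the coverability-style
-- search for well-structured systems on these.
--
-- A state lists the tokens of fractional part 0, followed by the buckets of
-- tokens sharing a positive fractional part, by increasing fractional part;
-- of each token it keeps the place and the integer part, capped at a number K
-- above all constants of the net. Which transitions can fire depends on this
-- information only, so steps of states are realised by steps of markings
-- (⇒⋆-sound) and steps of markings by steps of states (reach-complete). The
-- latter compares real ages and thus holds up to double negation, which is
-- enough because it serves to prove an inequality between naturals. For the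
-- rational ages of the initial marking the comparisons are decided, and its
-- state is computed (initial).
--
-- States are ordered by inserting tokens and buckets. This order is almost
-- full, by Higman's lemma for words of buckets over the same lemma for
-- buckets of letters (higman, ≼-af). Larger states simulate smaller ones and
-- keep their additional tokens (⇒-simulate). Each state has finitely many
-- successors, which can be listed (successors).
--
-- The tree of runs from the initial state is explored, without expanding a
-- state again below itself. Since the order is almost full, the exploration
-- ends, by induction on the proof that the order is so (explore). If some
-- state was found above a different ancestor, it is larger (≼-size); then the
-- run between the two can be repeated, with ever more tokens, and the net is
-- unbounded (pump-unbounded). Otherwise the finitely many states visited are
-- closed under steps, and their sizes bound those of all reachable markings
-- (pump-or-bounded).

open import Defs
open import Algebra.Bundles using (CommutativeMonoid)
import Algebra.Solver.CommutativeMonoid as CommutativeMonoidSolver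
open import Data.Empty using (⊥; ⊥-elim)
open import Data.Fin.Base as Fin using (Fin; zero; suc; toℕ; fromℕ<)
import Data.Fin.Properties as Fin
open import Data.Integer.Base as ℤ using (+_; -[1+_])
import Data.Integer.Properties as ℤ
open import Data.List.Base using (List; []; _∷_; _++_; map; concatMap; length; allFin; filter; upTo)
import Data.List.Properties as List
import Data.List.Membership.Propositional as Mem
open Mem using (_∈_)
import Data.List.Membership.Propositional.Properties as Mem
open import Data.List.Relation.Binary.Pointwise as Pointwise using (Pointwise; []; _∷_)
import Data.List.Relation.Binary.Permutation.Setoid as Permutation
import Data.List.Relation.Binary.Permutation.Setoid.Properties as PermutationProperties
open import Data.List.Relation.Binary.Sublist.Heterogeneous as Sublist using (Sublist; []; _∷ʳ_; _∷_; minimum)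
import Data.List.Relation.Binary.Sublist.Heterogeneous.Properties as Sublist
open import Data.List.Relation.Unary.All as All using (All; []; _∷_)
import Data.List.Relation.Unary.All.Properties as All
open import Data.List.Relation.Unary.Any as Any using (Any; here; there)
import Data.List.Relation.Unary.Any.Properties as Any
open import Data.Nat.Base as ℕ using (ℕ; zero; suc; z≤n; s≤s)
open import Data.Nat.ListAction using (sum)
open import Data.Nat.ListAction.Properties using (sum-++)
import Data.Nat.Properties as ℕ
open import Data.Nat.Tactic.RingSolver using (solve-∀)
open import Data.Product.Base using (Σ-syntax; ∃-syntax; _×_; _,_; proj₁; proj₂)
import Data.Product.Properties as Product
open import Data.Rational.Base as ℚ using (ℚ; mkℚ; 0ℚ)
import Data.Rational.Properties as ℚ
open import Data.Rational.Solver using (module +-*-Solver)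
open import Data.Rational.Unnormalised.Base as ℚᵘ using (mkℚᵘ)
import Data.Rational.Unnormalised.Properties as ℚᵘ
open import Data.Sum.Base as Sum using (_⊎_; inj₁; inj₂; [_,_]′)
open import Data.Unit.Base using (⊤; tt)
open import Effect.Monad using (RawMonad)
open import Function.Base using (_∘_; id; _on_)
open import Level using (0ℓ)
open import Relation.Binary.Bundles using (Setoid)
open import Relation.Binary.Construct.Closure.ReflexiveTransitive using (Star; ε; _◅_; _◅◅_)
open import Relation.Binary.Definitions using (Asymmetric; Decidable; DecidableEquality; _Respects₂_; tri<; tri≈; tri>)
import Relation.Binary.Reasoning.Base.Triple
open import Relation.Binary.Structures using (IsPreorder)
open import Relation.Binary.PropositionalEquality as ≡ using (_≡_; refl; sym; trans; cong; cong₂; subst)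
open import Relation.Nullary using (¬_; Dec; yes; no; contradiction; ¬¬-excluded-middle)
open import Relation.Nullary.Decidable as Dec using (_⊎-dec_; _×-dec_)
open import Relation.Nullary.Negation using (¬¬-Monad)
import Relation.Unary as Unary

------------------------------------------------------------------------
-- Almost full relations

infix 6 _↑_

-- R ↑ a relates y to z when R does, or when a is already below y.
_↑_ : ∀ {X : Set} → (X → X → Set) → X → (X → X → Set)
(R ↑ a) y z = R y z ⊎ R a y

-- The inductive counterpart of "every infinite sequence x₀ x₁ … has some
-- i < j with R xᵢ xⱼ".
data AlmostFull {X : Set} (R : X → X → Set) : Set₁ where
  full : (∀ y z → R y z) → AlmostFull R
  step : (∀ a → AlmostFull (R ↑ a)) → AlmostFull R

af-mono : ∀ {X : Set} {R S : X → X → Set} →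
  (∀ {y z} → R y z → S y z) → AlmostFull R → AlmostFull S
af-mono R⇒S (full r) = full λ y z → R⇒S (r y z)
af-mono R⇒S (step r) = step λ a → af-mono (Sum.map R⇒S R⇒S) (r a)

af-on : ∀ {X Y : Set} {R : X → X → Set} (f : Y → X) →
  AlmostFull R → AlmostFull (R on f)
af-on f (full r) = full λ y z → r (f y) (f z)
af-on f (step r) = step λ a → af-on f (r (f a))

-- The next three lemmas prove that almost full relations are closed under
-- intersection (a form of Ramsey's theorem), for alternatives P and Q
-- depending on none, one and both of the related elements.
af-∩₀ : ∀ {X : Set} {A B C : X → X → Set} {P Q : Set} →
  (∀ {y z} → A y z → C y z ⊎ P) → (∀ {y z} → B y z → C y z ⊎ Q) →
  AlmostFull A → AlmostFull B → AlmostFull (λ y z → C y z ⊎ (P × Q))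
af-∩₀ f g (full a) b = af-mono
  (λ {y} {z} r → [ inj₁ , (λ q → Sum.map₂ (_, q) (f (a y z))) ]′ (g r)) b
af-∩₀ {A = A} {C = C} {P} f g (step a) b = step λ x → af-mono regroup
  (af-∩₀ {C = C ↑ x} (f′ x) (Sum.map₁ inj₁ ∘ g) (a x) b)
  where
  f′ : ∀ x {y z} → (A ↑ x) y z → (C ↑ x) y z ⊎ P
  f′ x (inj₁ r) = Sum.map₁ inj₁ (f r)
  f′ x (inj₂ r) = Sum.map₁ inj₂ (f r)
  regroup : ∀ {D E F : Set} → (D ⊎ E) ⊎ F → (D ⊎ F) ⊎ (E ⊎ F)
  regroup (inj₁ (inj₁ d)) = inj₁ (inj₁ d)
  regroup (inj₁ (inj₂ e)) = inj₂ (inj₁ e)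
  regroup (inj₂ q)        = inj₁ (inj₂ q)

af-∩₁ : ∀ {X : Set} {A B C : X → X → Set} {P Q : X → Set} →
  (∀ {y z} → A y z → C y z ⊎ P y) → (∀ {y z} → B y z → C y z ⊎ Q y) →
  AlmostFull A → AlmostFull B → AlmostFull (λ y z → C y z ⊎ (P y × Q y))
af-∩₁ f g (full a) b = af-mono
  (λ {y} {z} r → [ inj₁ , (λ q → Sum.map₂ (_, q) (f (a y z))) ]′ (g r)) b
af-∩₁ f g a@(step _) (full b) = af-mono
  (λ {y} {z} r → [ inj₁ , (λ p → Sum.map₂ (p ,_) (g (b y z))) ]′ (f r)) a
af-∩₁ {X} {A} {B} {C} {P} {Q} f g (step a) (step b) = step λ x → af-mono regroup
  (af-∩₀ {C = λ y z → (C ↑ x) y z ⊎ (P y × Q y)} swap₂ swap₂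
    (af-∩₁ {C = λ y z → (C ↑ x) y z ⊎ P x} (f′ x) (Sum.map₁ (inj₁ ∘ inj₁) ∘ g) (a x) (step b))
    (af-∩₁ {C = λ y z → (C ↑ x) y z ⊎ Q x} (Sum.map₁ (inj₁ ∘ inj₁) ∘ f) (g′ x) (step a) (b x)))
  where
  f′ : ∀ x {y z} → (A ↑ x) y z → ((C ↑ x) y z ⊎ P x) ⊎ P y
  f′ x (inj₁ r) = Sum.map₁ (inj₁ ∘ inj₁) (f r)
  f′ x (inj₂ r) = [ inj₁ ∘ inj₁ ∘ inj₂ , inj₁ ∘ inj₂ ]′ (f r)
  g′ : ∀ x {y z} → (B ↑ x) y z → ((C ↑ x) y z ⊎ Q x) ⊎ Q y
  g′ x (inj₁ r) = Sum.map₁ (inj₁ ∘ inj₁) (g r)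
  g′ x (inj₂ r) = [ inj₁ ∘ inj₁ ∘ inj₂ , inj₁ ∘ inj₂ ]′ (g r)
  swap₂ : ∀ {D E F : Set} → (D ⊎ E) ⊎ F → (D ⊎ F) ⊎ E
  swap₂ (inj₁ (inj₁ d)) = inj₁ (inj₁ d)
  swap₂ (inj₁ (inj₂ e)) = inj₂ e
  swap₂ (inj₂ q)        = inj₁ (inj₂ q)
  regroup : ∀ {D E F G : Set} → ((D ⊎ E) ⊎ F) ⊎ G → (D ⊎ F) ⊎ (E ⊎ G)
  regroup (inj₁ (inj₁ (inj₁ d))) = inj₁ (inj₁ d)
  regroup (inj₁ (inj₁ (inj₂ e))) = inj₂ (inj₁ e)
  regroup (inj₁ (inj₂ q))        = inj₁ (inj₂ q)
  regroup (inj₂ q)               = inj₂ (inj₂ q)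

af-∩₂ : ∀ {X : Set} {A B C P Q : X → X → Set} →
  (∀ {y z} → A y z → C y z ⊎ P y z) → (∀ {y z} → B y z → C y z ⊎ Q y z) →
  AlmostFull A → AlmostFull B → AlmostFull (λ y z → C y z ⊎ (P y z × Q y z))
af-∩₂ f g (full a) b = af-mono
  (λ {y} {z} r → [ inj₁ , (λ q → Sum.map₂ (_, q) (f (a y z))) ]′ (g r)) b
af-∩₂ f g a@(step _) (full b) = af-mono
  (λ {y} {z} r → [ inj₁ , (λ p → Sum.map₂ (p ,_) (g (b y z))) ]′ (f r)) a
af-∩₂ {X} {A} {B} {C} {P} {Q} f g (step a) (step b) = step λ x → af-mono regroup
  (af-∩₁ {C = λ y z → (C ↑ x) y z ⊎ (P y z × Q y z)} {P x} {Q x} swap₂ swap₂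
    (af-∩₂ {C = λ y z → (C ↑ x) y z ⊎ P x y} (f′ x) (Sum.map₁ (inj₁ ∘ inj₁) ∘ g) (a x) (step b))
    (af-∩₂ {C = λ y z → (C ↑ x) y z ⊎ Q x y} (Sum.map₁ (inj₁ ∘ inj₁) ∘ f) (g′ x) (step a) (b x)))
  where
  f′ : ∀ x {y z} → (A ↑ x) y z → ((C ↑ x) y z ⊎ P x y) ⊎ P y z
  f′ x (inj₁ r) = Sum.map₁ (inj₁ ∘ inj₁) (f r)
  f′ x (inj₂ r) = [ inj₁ ∘ inj₁ ∘ inj₂ , inj₁ ∘ inj₂ ]′ (f r)
  g′ : ∀ x {y z} → (B ↑ x) y z → ((C ↑ x) y z ⊎ Q x y) ⊎ Q y z
  g′ x (inj₁ r) = Sum.map₁ (inj₁ ∘ inj₁) (g r)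
  g′ x (inj₂ r) = [ inj₁ ∘ inj₁ ∘ inj₂ , inj₁ ∘ inj₂ ]′ (g r)
  swap₂ : ∀ {D E F : Set} → (D ⊎ E) ⊎ F → (D ⊎ F) ⊎ E
  swap₂ (inj₁ (inj₁ d)) = inj₁ (inj₁ d)
  swap₂ (inj₁ (inj₂ e)) = inj₂ e
  swap₂ (inj₂ q)        = inj₁ (inj₂ q)
  regroup : ∀ {D E F G : Set} → ((D ⊎ E) ⊎ F) ⊎ G → (D ⊎ F) ⊎ (E ⊎ G)
  regroup (inj₁ (inj₁ (inj₁ d))) = inj₁ (inj₁ d)
  regroup (inj₁ (inj₁ (inj₂ e))) = inj₂ (inj₁ e)
  regroup (inj₁ (inj₂ q))        = inj₁ (inj₂ q)
  regroup (inj₂ q)               = inj₂ (inj₂ q)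

af-∩ : ∀ {X : Set} {R S : X → X → Set} →
  AlmostFull R → AlmostFull S → AlmostFull (λ y z → R y z × S y z)
af-∩ a b = af-mono [ ⊥-elim , id ]′ (af-∩₂ {C = λ _ _ → ⊥} inj₂ inj₂ a b)

af-≤ : AlmostFull ℕ._≤_
af-≤ = step go
  where
  go : ∀ n → AlmostFull (ℕ._≤_ ↑ n)
  go zero    = full λ _ _ → inj₂ z≤n
  go (suc n) = step λ x → case x (ℕ.≤-total x n)
    where
    case : ∀ x → x ℕ.≤ n ⊎ n ℕ.≤ x → AlmostFull ((ℕ._≤_ ↑ suc n) ↑ x)
    case x (inj₁ x≤n) = af-mono
      [ inj₁ ∘ inj₁ , (λ n≤y → inj₂ (inj₁ (ℕ.≤-trans x≤n n≤y))) ]′ (go n)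
    case x (inj₂ n≤x) with ℕ.m≤n⇒m<n∨m≡n n≤x
    ... | inj₁ n<x  = full λ _ _ → inj₂ (inj₂ n<x)
    ... | inj₂ refl = af-mono [ inj₁ ∘ inj₁ , inj₂ ∘ inj₁ ]′ (go n)

-- Two numbers below n are equal when both they and their complements are
-- in order.
af-Fin : ∀ {n} → AlmostFull {Fin n} _≡_
af-Fin = af-mono
  (λ {i} {j} (i≤j , i′≤j′) → Fin.toℕ-injective (ℕ.≤-antisym i≤j (opposite⁻ i j i′≤j′)))
  (af-∩ (af-on toℕ af-≤) (af-on (toℕ ∘ Fin.opposite) af-≤))
  where
  opposite⁻ : ∀ {n} (i j : Fin n) → toℕ (Fin.opposite i) ℕ.≤ toℕ (Fin.opposite j) → toℕ j ℕ.≤ toℕ i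
  opposite⁻ i j h rewrite Fin.opposite-prop i | Fin.opposite-prop j =
    ℕ.s≤s⁻¹ (ℕ.∸-cancelʳ-≤ (Fin.toℕ<n j) h)

af-× : ∀ {X Y : Set} → AlmostFull {X} _≡_ → AlmostFull {Y} _≡_ → AlmostFull {X × Y} _≡_
af-× a b = af-mono (λ (p , q) → cong₂ _,_ p q) (af-∩ (af-on proj₁ a) (af-on proj₂ b))

------------------------------------------------------------------------
-- Higman's lemma

↑-dec : ∀ {X : Set} {R : X → X → Set} → Decidable R → ∀ a → Decidable (R ↑ a)
↑-dec R? a y z = R? y z ⊎-dec R? a y

-- A word is cut at its first letter above a: the letters before it avoid
-- a, so that R ↑ a compares them as R does.
module _ {X : Set} {R : X → X → Set} (R? : Decidable R) (a : X) where

  before : List X → List X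
  before []       = []
  before (u ∷ us) with R? a u
  ... | yes _ = []
  ... | no  _ = u ∷ before us

  from : List X → List X
  from []       = []
  from (u ∷ us) with R? a u
  ... | yes _ = u ∷ us
  ... | no  _ = from us

  before++from : ∀ us → before us ++ from us ≡ us
  before++from []       = refl
  before++from (u ∷ us) with R? a u
  ... | yes _ = refl
  ... | no  _ = cong (u ∷_) (before++from us)

  before-avoids : ∀ us → All (λ u → ¬ R a u) (before us)
  before-avoids []       = []
  before-avoids (u ∷ us) with R? a u
  ... | yes _   = []
  ... | no  ¬au = ¬au ∷ before-avoids us

  from-above : ∀ us {u us′} → from us ≡ u ∷ us′ → R a u
  from-above []       ()
  from-above (u ∷ us) eq with R? a u
  from-above (u ∷ us) refl | yes au = au
  from-above (u ∷ us) eq   | no  _  = from-above us eq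

  avoiding-↑ : ∀ {us vs} → All (λ u → ¬ R a u) us → Sublist (R ↑ a) us vs → Sublist R us vs
  avoiding-↑ []        []              = []
  avoiding-↑ ¬a        (v ∷ʳ e)        = v ∷ʳ avoiding-↑ ¬a e
  avoiding-↑ (¬a ∷ ¬as) (inj₁ r ∷ e)   = r ∷ avoiding-↑ ¬as e
  avoiding-↑ (¬a ∷ ¬as) (inj₂ au ∷ e)  = contradiction au ¬a

-- 0 for the empty word and 1 for all others, so that comparing two words by
-- it excludes that only the first is nonempty.
nonempty : ∀ {X : Set} → List X → ℕ
nonempty []      = 0
nonempty (_ ∷ _) = 1

headOr : ∀ {X : Set} → X → List X → X
headOr a []      = a
headOr a (u ∷ _) = u

tail : ∀ {X : Set} → List X → List X
tail []       = []
tail (_ ∷ us) = us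

-- Sublist R compares words by Higman's ordering. That a word w = a ∷ w′ may
-- have come first is dealt with by induction on w: a word without letters
-- above a is compared by R ↑ a; any other is cut at the first such letter,
-- into a part avoiding a, the letter, and a remainder, which is compared
-- assuming that w′ came first.
higman : ∀ {X : Set} {R : X → X → Set} → Decidable R → AlmostFull R → AlmostFull (Sublist R)
higman {R = R} R? (full r) = af-mono embed (af-on length af-≤)
  where
  embed : ∀ {us vs} → length us ℕ.≤ length vs → Sublist R us vs
  embed {[]}     {vs}     _         = minimum vs
  embed {u ∷ us} {v ∷ vs} (s≤s len) = r u v ∷ embed len
higman {X} {R} R? (step r) = step go
  where
  go : ∀ w → AlmostFull (Sublist R ↑ w)
  go []      = full λ us _ → inj₂ (minimum us)
  go (a ∷ w) = af-mono combine
    (af-∩ (af-on (before R? a) (higman (↑-dec R? a) (r a)))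
    (af-∩ (af-on (nonempty ∘ from R? a) af-≤)
    (af-∩ (af-on (headOr a ∘ from R? a) (step r))
          (af-on (tail ∘ from R? a) (go w)))))
    where
    Compatible : List X → List X → Set
    Compatible us vs =
        Sublist (R ↑ a) (before R? a us) (before R? a vs)
      × nonempty (from R? a us) ℕ.≤ nonempty (from R? a vs)
      × R (headOr a (from R? a us)) (headOr a (from R? a vs))
      × (Sublist R ↑ w) (tail (from R? a us)) (tail (from R? a vs))

    -- If w embeds in the remainder of us, then a ∷ w embeds in us, the letter
    -- at the cut being above a.
    combine : ∀ {us vs} → Compatible us vs → (Sublist R ↑ (a ∷ w)) us vs
    combine {us} {vs} (e , n , h , t)
      with from R? a us in eqᵤ | from R? a vs in eqᵥ
         | before++from R? a us | before++from R? a vs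
         | avoiding-↑ R? a (before-avoids R? a us) e
    ... | []     | vs′    | us≡ | vs≡ | e′ = inj₁ (≡.subst₂ (Sublist R)
            (trans (sym (List.++-identityʳ _)) us≡) vs≡ (Sublist.++ʳ vs′ e′))
    ... | u ∷ us′ | v ∷ vs′ | us≡ | vs≡ | e′ with t
    ...   | inj₁ t′ = inj₁ (≡.subst₂ (Sublist R) us≡ vs≡ (Sublist.++⁺ e′ (h ∷ t′)))
    ...   | inj₂ t′ = inj₂ (subst (Sublist R (a ∷ w)) us≡
            (Sublist.++ˡ (before R? a us) (from-above R? a us eqᵤ ∷ t′)))
    combine (e , () , h , t) | u ∷ us′ | [] | us≡ | vs≡ | e′

------------------------------------------------------------------------
-- Exploration of a finitely branching system

-- A list of exactly the elements satisfying P.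
Listing : ∀ {B : Set} → (B → Set) → Set
Listing {B} P = Σ[ bs ∈ List B ] (∀ {b} → b ∈ bs → P b) × (∀ {b} → P b → b ∈ bs)

-- Every element has finitely many images, which can be listed.
Enumerable : ∀ {A B : Set} → (A → B → Set) → Set
Enumerable R = ∀ a → Listing (R a)

listing-⇔ : ∀ {B : Set} {P Q : B → Set} → (∀ {b} → P b → Q b) → (∀ {b} → Q b → P b) → Listing P → Listing Q
listing-⇔ to from (bs , sound , complete) = bs , to ∘ sound , complete ∘ from

listing-∅ : ∀ {B : Set} {P : B → Set} → (∀ {b} → ¬ P b) → Listing P
listing-∅ ¬p = [] , (λ ()) , ⊥-elim ∘ ¬p

listing-⊎ : ∀ {B : Set} {P Q : B → Set} → Listing P → Listing Q → Listing (λ b → P b ⊎ Q b)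
listing-⊎ (bs , s , c) (bs′ , s′ , c′) = bs ++ bs′
  , Sum.map s s′ ∘ Mem.∈-++⁻ bs
  , [ Mem.∈-++⁺ˡ ∘ c , Mem.∈-++⁺ʳ bs ∘ c′ ]′

listing-if : ∀ {A B : Set} → Dec A → (c : B) → Listing (λ b → A × c ≡ b)
listing-if (yes a) c = c ∷ [] , (λ { (here refl) → a , refl }) , λ { (_ , refl) → here refl }
listing-if (no ¬a) c = listing-∅ (¬a ∘ proj₁)

listing-bind : ∀ {A B : Set} {P : A → Set} {Q : A → B → Set} →
  Listing P → Enumerable Q → Listing (λ b → ∃[ a ] P a × Q a b)
listing-bind {P = P} {Q} (as , s , c) q = concatMap (proj₁ ∘ q) as , sound , complete
  where
  sound : ∀ {b} → b ∈ concatMap (proj₁ ∘ q) as → ∃[ a ] P a × Q a b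
  sound m = let a , a∈ , b∈ = Mem.find (Mem.∈-concatMap⁻ (proj₁ ∘ q) {xs = as} m) in a , s a∈ , proj₁ (proj₂ (q a)) b∈
  complete : ∀ {b} → (∃[ a ] P a × Q a b) → b ∈ concatMap (proj₁ ∘ q) as
  complete (a , pa , qab) = Mem.∈-concatMap⁺ (proj₁ ∘ q) {xs = as} (Mem.lose (c pa) (proj₂ (proj₂ (q a)) qab))

listing-map : ∀ {A B : Set} {P : A → Set} (f : A → B) → Listing P → Listing (λ b → ∃[ a ] P a × f a ≡ b)
listing-map f p = listing-⇔ (λ { (a , pa , _ , eq) → a , pa , eq }) (λ { (a , pa , eq) → a , pa , tt , eq })
  (listing-bind p λ a → listing-if (yes tt) (f a))

listing-Fin : ∀ {n} → Listing {Fin n} (λ _ → ⊤)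
listing-Fin = allFin _ , (λ _ → tt) , λ _ → Mem.∈-allFin _

module Exploration
  {S : Set} (_≟_ : DecidableEquality S)
  {_⇒_ : S → S → Set} (successors : Enumerable _⇒_)
  (size : S → ℕ)
  {_≼_ : S → S → Set} (≼-af : AlmostFull _≼_)
  (Inv : S → Set) (inv-step : ∀ {s t} → s ⇒ t → Inv t)
  (≼-size : ∀ {s t} → Inv s → Inv t → s ≼ t → size s ℕ.< size t ⊎ s ≡ t)
  (s₀ : S) (inv₀ : Inv s₀)
  where

  open import Data.List.Membership.DecPropositional _≟_ using (_∈?_)

  -- A reachable state from which a larger state above it is reachable.
  Pump : Set
  Pump = ∃[ s ] ∃[ t ] Star _⇒_ s₀ s × Star _⇒_ s t × s ≼ t × size s ℕ.< size t

  private
    -- States already expanded on the current branch, which ends in s.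
    History : List S → S → Set
    History H s = All (λ h → Inv h × Star _⇒_ s₀ h × Star _⇒_ h s) H

    -- Steps from L lead to L or back to the history.
    Closed : List S → List S → Set
    Closed H L = ∀ {s t} → s ∈ L → s ⇒ t → t ∈ L ⊎ t ∈ H

    -- R is an unfolding of _≼_ along the history: if it relates y to z, then z
    -- is above y, or y is above a state of the history, or a pump is found.
    Unfolds : (S → S → Set) → List S → Set
    Unfolds R H = ∀ {y z} → R y z → (y ≼ z ⊎ Any (_≼ y) H) ⊎ Pump

    extend : ∀ {H s t} → History H s → Inv s → Star _⇒_ s₀ s → s ⇒ t → History (s ∷ H) t
    extend hist i r st = (i , r , st ◅ ε) ∷ All.map (λ (i , r , r′) → i , r , r′ ◅◅ (st ◅ ε)) hist

    -- A state that is above an expanded one pumps or repeats it.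
    above : ∀ {H s} → History H s → Inv s → Any (_≼ s) H → Pump ⊎ s ∈ H
    above ((i , r , r′) ∷ _) j (here h≼s) =
      [ (λ lt → inj₁ (_ , _ , r , r′ , h≼s , lt)) , inj₂ ∘ here ∘ sym ]′ (≼-size i j h≼s)
    above (_ ∷ hist) j (there p) = Sum.map₂ there (above hist j p)

    -- Every state listed is either expanded already or explored below s.
    Visited : List S → List S → Set
    Visited H ts = ∃[ L ] (∀ {t} → t ∈ ts → t ∈ L ⊎ t ∈ H) × Closed H L

    visitAll : ∀ {H} ts → (∀ {t} → t ∈ ts → t ∈ H ⊎ (Pump ⊎ Visited H (t ∷ []))) → Pump ⊎ Visited H ts
    visitAll []       visit = inj₂ ([] , (λ ()) , λ ())
    visitAll {H} (t ∷ ts) visit with visit (here refl) | visitAll ts (visit ∘ there)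
    ... | inj₂ (inj₁ p)             | _      = inj₁ p
    ... | _                         | inj₁ p = inj₁ p
    ... | inj₁ t∈H | inj₂ (L , c , cl) =
      inj₂ (L , (λ { (here refl) → inj₂ t∈H ; (there m) → c m }) , cl)
    ... | inj₂ (inj₂ (L′ , c′ , cl′)) | inj₂ (L , c , cl) =
      inj₂ (L′ ++ L , cover , isClosed)
      where
      cover : ∀ {u} → u ∈ t ∷ ts → u ∈ L′ ++ L ⊎ u ∈ H
      cover (here refl) = Sum.map₁ Mem.∈-++⁺ˡ (c′ (here refl))
      cover (there m)   = Sum.map₁ (Mem.∈-++⁺ʳ L′) (c m)
      isClosed : Closed H (L′ ++ L)
      isClosed m st with Mem.∈-++⁻ L′ m
      ... | inj₁ m′ = Sum.map₁ Mem.∈-++⁺ˡ (cl′ m′ st)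
      ... | inj₂ m′ = Sum.map₁ (Mem.∈-++⁺ʳ L′) (cl m′ st)

    -- The state s itself, once its successors are visited.
    close : ∀ {H s} → Visited (s ∷ H) (proj₁ (successors s)) → Visited H (s ∷ [])
    close {H} {s} (L , c , cl) = s ∷ L , (λ { (here refl) → inj₁ (here refl) }) , isClosed
      where
      move : ∀ {t} → t ∈ L ⊎ t ∈ s ∷ H → t ∈ s ∷ L ⊎ t ∈ H
      move (inj₁ m)           = inj₁ (there m)
      move (inj₂ (here refl)) = inj₁ (here refl)
      move (inj₂ (there m))   = inj₂ m
      isClosed : Closed H (s ∷ L)
      isClosed (here refl) st = move (c (proj₂ (proj₂ (successors s)) st))
      isClosed (there m)   st = move (cl m st)

    -- By induction on the proof that R is almost full; at a leaf R holds
    -- between s and all its successors, each of which thus pumps or repeats a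
    -- state.
    explore : ∀ {R} → AlmostFull R → ∀ H s → Unfolds R H → ¬ s ∈ H →
      Inv s → Star _⇒_ s₀ s → History H s → Pump ⊎ Visited H (s ∷ [])
    explore {R} af H s unf s∉H inv r hist = Sum.map₂ close (visitAll (proj₁ (successors s)) (visit af unf))
      where
      visit : ∀ {R t} → AlmostFull R → Unfolds R H → t ∈ proj₁ (successors s) →
        t ∈ s ∷ H ⊎ (Pump ⊎ Visited (s ∷ H) (t ∷ []))
      visit {R} {t} af unf m with proj₁ (proj₂ (successors s)) m | t ∈? (s ∷ H)
      ... | _  | yes t∈ = inj₁ t∈
      ... | st | no  t∉ = inj₂ (descend af unf)
        where
        hist′ : History (s ∷ H) t
        hist′ = extend hist inv r st
        descend : ∀ {R} → AlmostFull R → Unfolds R H → Pump ⊎ Visited (s ∷ H) (t ∷ [])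
        descend (full f) unf with unf (f s t)
        ... | inj₂ p            = inj₁ p
        ... | inj₁ (inj₁ s≼t)   = inj₁ ([ id , ⊥-elim ∘ t∉ ]′ (above hist′ (inv-step st) (here s≼t)))
        ... | inj₁ (inj₂ above-s) = inj₁ ([ id , ⊥-elim ∘ s∉H ]′ (above hist inv above-s))
        descend {R} (step f) unf = explore (f s) (s ∷ H) t unf′ t∉ (inv-step st) (r ◅◅ (st ◅ ε)) hist′
          where
          unf′ : Unfolds (R ↑ s) (s ∷ H)
          unf′ (inj₁ ryz) = Sum.map₁ (Sum.map₂ there) (unf ryz)
          unf′ (inj₂ rsy) with unf rsy
          ... | inj₂ p              = inj₂ p
          ... | inj₁ (inj₁ s≼y)     = inj₁ (inj₂ (here s≼y))
          ... | inj₁ (inj₂ above-s) = inj₂ ([ id , ⊥-elim ∘ s∉H ]′ (above hist inv above-s))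

  -- Either some reachable state can be pumped, or the reachable states
  -- are among finitely many, whose sizes are bounded by their sum.
  pump-or-bounded : Pump ⊎ ∃[ c ] (∀ {s} → Star _⇒_ s₀ s → size s ℕ.≤ c)
  pump-or-bounded with explore ≼-af [] s₀ (inj₁ ∘ inj₁) (λ ()) inv₀ ε []
  ... | inj₁ p            = inj₁ p
  ... | inj₂ (L , c , cl) = inj₂ (sum (map size L) , λ r → size≤sum L (stays r s₀∈L))
    where
    s₀∈L : s₀ ∈ L
    s₀∈L = [ id , (λ ()) ]′ (c (here refl))
    stays : ∀ {s t} → Star _⇒_ s t → s ∈ L → t ∈ L
    stays ε        m = m
    stays (st ◅ r) m = stays r ([ id , (λ ()) ]′ (cl m st))
    size≤sum : ∀ L {s} → s ∈ L → size s ℕ.≤ sum (map size L)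
    size≤sum (s ∷ L) (here refl) = ℕ.m≤m+n (size s) _
    size≤sum (s ∷ L) (there m)   = ℕ.≤-trans (size≤sum L m) (ℕ.m≤n+m _ (size s))

  -- With steps compatible with _≼_ and insensitive to the extra tokens,
  -- a pump can be repeated to exceed any bound.
  module _
    (simulate : ∀ {s t s′} → s ≼ t → s ⇒ s′ →
      ∃[ t′ ] t ⇒ t′ × s′ ≼ t′ × size s′ ℕ.+ size t ≡ size s ℕ.+ size t′)
    where

    simulate⋆ : ∀ {s t s′} → s ≼ t → Star _⇒_ s s′ →
      ∃[ t′ ] Star _⇒_ t t′ × s′ ≼ t′ × size s′ ℕ.+ size t ≡ size s ℕ.+ size t′
    simulate⋆ {s} {t} s≼t ε = t , ε , s≼t , refl
    simulate⋆ {s} {t} {s″} s≼t (_◅_ {j = s′} st r) with simulate s≼t st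
    ... | t′ , st′ , s′≼t′ , eq with simulate⋆ s′≼t′ r
    ...   | t″ , r′ , s″≼t″ , eq′ =
      t″ , st′ ◅ r′ , s″≼t″ , ℕ.+-cancelʳ-≡ (size s′ ℕ.+ size t′) _ _ (begin
        size s″ ℕ.+ size t ℕ.+ (size s′ ℕ.+ size t′)
          ≡⟨ shuffle (size s″) (size t) (size s′) (size t′) ⟩
        (size s′ ℕ.+ size t) ℕ.+ (size s″ ℕ.+ size t′)
          ≡⟨ cong₂ ℕ._+_ eq eq′ ⟩
        (size s ℕ.+ size t′) ℕ.+ (size s′ ℕ.+ size t″)
          ≡⟨ shuffle′ (size s) (size t′) (size s′) (size t″) ⟩
        size s ℕ.+ size t″ ℕ.+ (size s′ ℕ.+ size t′) ∎)
      where
      open ≡.≡-Reasoning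
      shuffle : ∀ a b c d → a ℕ.+ b ℕ.+ (c ℕ.+ d) ≡ (c ℕ.+ b) ℕ.+ (a ℕ.+ d)
      shuffle = solve-∀
      shuffle′ : ∀ a b c d → (a ℕ.+ b) ℕ.+ (c ℕ.+ d) ≡ a ℕ.+ d ℕ.+ (c ℕ.+ b)
      shuffle′ = solve-∀

    pump-unbounded : Pump → ∀ n → ∃[ u ] Star _⇒_ s₀ u × n ℕ.≤ size u
    pump-unbounded (s , t , r , r′ , s≼t , lt) n =
      let u , _ , rᵤ , _ , n≤ = go n in u , r ◅◅ rᵤ , n≤
      where
      go : ∀ n → ∃[ u ] ∃[ v ] Star _⇒_ s u × (Star _⇒_ u v × u ≼ v × size u ℕ.< size v) × n ℕ.≤ size u
      go zero    = s , t , ε , (r′ , s≼t , lt) , z≤n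
      go (suc n) with go n
      ... | u , v , rᵤ , (rᵥ , u≼v , u<v) , n≤u with simulate⋆ u≼v rᵥ
      ...   | w , r_w , v≼w , eq =
        v , w , rᵤ ◅◅ rᵥ , (r_w , v≼w , ℕ.+-cancelˡ-< (size u) _ _ (begin-strict
          size u ℕ.+ size v <⟨ ℕ.+-monoˡ-< (size v) u<v ⟩
          size v ℕ.+ size v ≡⟨ eq ⟩
          size u ℕ.+ size w ∎)) , ℕ.≤-trans (s≤s n≤u) u<v
        where open ℕ.≤-Reasoning

------------------------------------------------------------------------
-- The ordered abelian group of real numbers

0≤δ : ∀ n → 0ℚ ℚ.≤ δ n
0≤δ n = ℚ.nonNegative⁻¹ (δ n) {{ℚ.normalize-nonNeg 1 (suc n)}}

0<δ : ∀ n → 0ℚ ℚ.< δ n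
0<δ n = ℚ.positive⁻¹ (δ n) {{ℚ.normalize-pos 1 (suc n)}}

δ-half-≤ : ∀ n → δ (half n) ℚ.≤ δ n
δ-half-≤ n = begin
  δ (half n)                    ≡⟨ ℚ.+-identityʳ _ ⟨
  δ (half n) ℚ.+ 0ℚ             ≤⟨ ℚ.+-monoʳ-≤ (δ (half n)) (0≤δ (half n)) ⟩
  δ (half n) ℚ.+ δ (half n)     ≡⟨ δ-half n ⟩
  δ n                           ∎
  where open ℚ.≤-Reasoning

-- The next lemmas are the rational estimates behind associativity and the
-- strict order, with arbitrary rationals for approximations and precisions.
assoc-ℚ : ∀ {xa xb ya yb za zb da daa db dbb dm dn} →
  xa ℚ.≤ xb ℚ.+ (daa ℚ.+ db) → ya ℚ.≤ yb ℚ.+ (daa ℚ.+ dbb) → za ℚ.≤ zb ℚ.+ (da ℚ.+ dbb) →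
  daa ℚ.+ daa ≡ da → da ℚ.+ da ≡ dm → dbb ℚ.+ dbb ≡ db → db ℚ.+ db ≡ dn →
  (xa ℚ.+ ya) ℚ.+ za ℚ.≤ (xb ℚ.+ (yb ℚ.+ zb)) ℚ.+ (dm ℚ.+ dn)
assoc-ℚ {xa} {xb} {ya} {yb} {za} {zb} {_} {daa} {_} {dbb} p q r refl refl refl refl =
  subst ((xa ℚ.+ ya) ℚ.+ za ℚ.≤_) (regroup xb yb zb daa (daa ℚ.+ daa) dbb (dbb ℚ.+ dbb)) (ℚ.+-mono-≤ (ℚ.+-mono-≤ p q) r)
  where
  regroup : ∀ x y z aa a bb b →
        ((x ℚ.+ (aa ℚ.+ b)) ℚ.+ (y ℚ.+ (aa ℚ.+ bb))) ℚ.+ (z ℚ.+ (a ℚ.+ bb))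
          ≡ (x ℚ.+ (y ℚ.+ z)) ℚ.+ (((aa ℚ.+ aa) ℚ.+ a) ℚ.+ ((bb ℚ.+ bb) ℚ.+ b))
  regroup = solve 7 (λ x y z aa a bb b →
        ((x ⊞ (aa ⊞ b)) ⊞ (y ⊞ (aa ⊞ bb))) ⊞ (z ⊞ (a ⊞ bb))
          ⊜ (x ⊞ (y ⊞ z)) ⊞ (((aa ⊞ aa) ⊞ a) ⊞ ((bb ⊞ bb) ⊞ b))) refl
      where open CommutativeMonoidSolver ℚ.+-0-commutativeMonoid renaming (_⊕_ to _⊞_)

p<q⇒0<q-p : ∀ {p q} → p ℚ.< q → 0ℚ ℚ.< q ℚ.- p
p<q⇒0<q-p {p} {q} p<q = subst (ℚ._< q ℚ.- p) (ℚ.+-inverseʳ p) (ℚ.+-monoˡ-< (ℚ.- p) p<q)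

gap-ℚ : ∀ {xm xh yn yj dm dn di dh dj dk} →
  xh ℚ.≤ xm ℚ.+ (dh ℚ.+ dm) → yn ℚ.≤ yj ℚ.+ (dn ℚ.+ dj) → dh ℚ.≤ di →
  dk ℚ.≤ yn ℚ.- (xm ℚ.+ (dm ℚ.+ dn)) → xh ℚ.+ dk ℚ.≤ yj ℚ.+ (di ℚ.+ dj)
gap-ℚ {xm} {xh} {yn} {yj} {dm} {dn} {di} {dh} {dj} {dk} p q r s = begin
  xh ℚ.+ dk
    ≤⟨ ℚ.+-mono-≤ p s ⟩
  (xm ℚ.+ (dh ℚ.+ dm)) ℚ.+ (yn ℚ.- (xm ℚ.+ (dm ℚ.+ dn)))
    ≡⟨ solve 5 (λ x y h m n → (x :+ (h :+ m)) :+ (y :- (x :+ (m :+ n))) := y :+ (h :- n)) refl xm yn dh dm dn ⟩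
  yn ℚ.+ (dh ℚ.- dn)
    ≤⟨ ℚ.+-mono-≤ q (ℚ.+-monoˡ-≤ (ℚ.- dn) r) ⟩
  (yj ℚ.+ (dn ℚ.+ dj)) ℚ.+ (di ℚ.- dn)
    ≡⟨ solve 4 (λ y n j i → (y :+ (n :+ j)) :+ (i :- n) := y :+ (i :+ j)) refl yj dn dj di ⟩
  yj ℚ.+ (di ℚ.+ dj) ∎
  where
  open ℚ.≤-Reasoning
  open +-*-Solver

gap-ℚ′ : ∀ {x y d d′ dh dk′ dk} → x ℚ.+ dk ℚ.≤ y ℚ.+ (d ℚ.+ d) → d′ ℚ.≤ d →
  d ℚ.+ d ≡ dh → dh ℚ.+ dh ≡ dk′ → dk′ ℚ.+ dk′ ≡ dk → 0ℚ ℚ.< dk′ →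
  x ℚ.+ (d′ ℚ.+ d) ℚ.< y
gap-ℚ′ {x} {y} {d} {d′} {dh} {dk′} {dk} p d′≤d refl refl refl 0<dk′ = begin-strict
  x ℚ.+ (d′ ℚ.+ d)
    ≤⟨ ℚ.+-monoʳ-≤ x (ℚ.+-monoˡ-≤ d d′≤d) ⟩
  x ℚ.+ dh
    ≡⟨ solve 2 (λ x h → x :+ h := (x :+ ((h :+ h) :+ (h :+ h))) :- (h :+ (h :+ h))) refl x dh ⟩
  (x ℚ.+ dk) ℚ.- (dh ℚ.+ (dh ℚ.+ dh))
    ≤⟨ ℚ.+-monoˡ-≤ _ p ⟩
  (y ℚ.+ dh) ℚ.- (dh ℚ.+ (dh ℚ.+ dh))
    ≡⟨ solve 2 (λ y h → (y :+ h) :- (h :+ (h :+ h)) := y :- (h :+ h)) refl y dh ⟩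
  y ℚ.- dk′
    <⟨ ℚ.+-monoʳ-< y (ℚ.neg-antimono-< 0<dk′) ⟩
  y ℚ.+ 0ℚ
    ≡⟨ ℚ.+-identityʳ y ⟩
  y ∎
  where
  open ℚ.≤-Reasoning
  open +-*-Solver

infix 4 _⊑_ _⊏_
infixl 6 _∔_
infix 8 ⊖_

-- The order relations, addition and the embeddings of ℚ and ℕ are repeated in
-- opaque form: unfolded, they are statements on sequences of rationals, from
-- which the reals concerned cannot be inferred.
abstract
  _⊑_ _⊏_ : ℝ → ℝ → Set
  x ⊑ y = x ≤ y
  x ⊏ y = x < y

  _∔_ : ℝ → ℝ → ℝ
  x ∔ y = x + y

  κ : ℚ → ℝ
  κ = fromℚ

  ι : ℕ → ℝ
  ι = fromℕ

  ⊖_ : ℝ → ℝ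
  (⊖ x) .approx n    = ℚ.- approx x n
  (⊖ x) .regular m n = begin
    ℚ.- approx x m
      ≡⟨ before-neg (approx x m) (approx x n) ⟩
    approx x n ℚ.+ (ℚ.- approx x m ℚ.- approx x n)
      ≤⟨ ℚ.+-monoˡ-≤ _ (regular x n m) ⟩
    approx x m ℚ.+ (δ n ℚ.+ δ m) ℚ.+ (ℚ.- approx x m ℚ.- approx x n)
      ≡⟨ after-neg (approx x m) (approx x n) (δ m) (δ n) ⟩
    ℚ.- approx x n ℚ.+ (δ m ℚ.+ δ n) ∎
    where
    open ℚ.≤-Reasoning
    open +-*-Solver
    before-neg : ∀ a b → ℚ.- a ≡ b ℚ.+ (ℚ.- a ℚ.- b)
    before-neg = solve 2 (λ a b → :- a := b :+ (:- a :- b)) refl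
    after-neg : ∀ a b m n → a ℚ.+ (n ℚ.+ m) ℚ.+ (ℚ.- a ℚ.- b) ≡ ℚ.- b ℚ.+ (m ℚ.+ n)
    after-neg = solve 4 (λ a b m n → a :+ (n :+ m) :+ (:- a :- b) := :- b :+ (m :+ n)) refl

  ι≡κ : ∀ n → ι n ≡ κ (+ n ℚ./ 1)
  ι≡κ n = refl

  ⊑-refl : ∀ {x} → x ⊑ x
  ⊑-refl {x} = ≤-refl {x}

  ⊑-trans : ∀ {x y z} → x ⊑ y → y ⊑ z → x ⊑ z
  ⊑-trans {x} {y} {z} p q = ≤-trans {x} {y} {z} p q

  ∔-mono-⊑ : ∀ {x y z w} → x ⊑ y → z ⊑ w → x ∔ z ⊑ y ∔ w
  ∔-mono-⊑ {x} {y} {z} {w} p q m n =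
    sum-≤ (approx x (half m)) (approx y (half n)) (approx z (half m)) (approx w (half n)) m n
      (p (half m) (half n)) (q (half m) (half n))

  ∔-comm-⊑ : ∀ x y → x ∔ y ⊑ y ∔ x
  ∔-comm-⊑ x y m n = subst (λ u → approx x (half m) ℚ.+ approx y (half m) ℚ.≤ u ℚ.+ (δ m ℚ.+ δ n))
    (ℚ.+-comm (approx x (half n)) (approx y (half n)))
    (regular (x + y) m n)

  ∔-assoc-⊑ : ∀ x y z → (x ∔ y) ∔ z ⊑ x ∔ (y ∔ z)
  ∔-assoc-⊑ x y z m n = assoc-ℚ
    {xb = approx x (half n)} {yb = approx y (half (half n))} {zb = approx z (half (half n))}
    {da = δ (half m)} {daa = δ (half (half m))} {db = δ (half n)} {dbb = δ (half (half n))} {dm = δ m} {dn = δ n}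
    (regular x (half (half m)) (half n)) (regular y (half (half m)) (half (half n)))
    (regular z (half m) (half (half n)))
    (δ-half (half m)) (δ-half m) (δ-half (half n)) (δ-half n)

  ∔-identityʳ-⊑ : ∀ x → x ∔ κ 0ℚ ⊑ x
  ∔-identityʳ-⊑ x m n = subst (ℚ._≤ approx x n ℚ.+ (δ m ℚ.+ δ n)) (sym (ℚ.+-identityʳ (approx x (half m))))
    (ℚ.≤-trans (regular x (half m) n)
      (ℚ.+-monoʳ-≤ (approx x n) (ℚ.+-monoˡ-≤ (δ n) (δ-half-≤ m))))

  ∔-identityʳ-⊒ : ∀ x → x ⊑ x ∔ κ 0ℚ
  ∔-identityʳ-⊒ x m n = subst (λ u → approx x m ℚ.≤ u ℚ.+ (δ m ℚ.+ δ n)) (sym (ℚ.+-identityʳ (approx x (half n))))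
    (ℚ.≤-trans (regular x m (half n))
      (ℚ.+-monoʳ-≤ (approx x (half n)) (ℚ.+-monoʳ-≤ (δ m) (δ-half-≤ n))))

  ∔-inverseʳ-⊑ : ∀ x → x ∔ ⊖ x ⊑ κ 0ℚ
  ∔-inverseʳ-⊑ x m n = subst (ℚ._≤ 0ℚ ℚ.+ (δ m ℚ.+ δ n)) (sym (ℚ.+-inverseʳ (approx x (half m)))) (regular 0ℝ m n)

  ∔-inverseʳ-⊒ : ∀ x → κ 0ℚ ⊑ x ∔ ⊖ x
  ∔-inverseʳ-⊒ x m n = subst (λ u → 0ℚ ℚ.≤ u ℚ.+ (δ m ℚ.+ δ n)) (sym (ℚ.+-inverseʳ (approx x (half n)))) (regular 0ℝ m n)

  κ-mono : ∀ {p q} → p ℚ.≤ q → κ p ⊑ κ q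
  κ-mono {p} {q} p≤q m n = ℚ.≤-trans p≤q (regular (fromℚ q) m n)

  κ-∔-⊑ : ∀ p q → κ (p ℚ.+ q) ⊑ κ p ∔ κ q
  κ-∔-⊑ p q = regular (fromℚ (p ℚ.+ q))

  κ-∔-⊒ : ∀ p q → κ p ∔ κ q ⊑ κ (p ℚ.+ q)
  κ-∔-⊒ p q = regular (fromℚ (p ℚ.+ q))

  κ-bound : ∀ x → x ⊑ κ (approx x 0 ℚ.+ δ 0)
  κ-bound x m n = ℚ.≤-trans (regular x m 0) (bound (approx x 0) (δ m) (δ 0) (δ n) (0≤δ n))
    where
    open ℚ.≤-Reasoning
    open +-*-Solver
    bound : ∀ a m z n → 0ℚ ℚ.≤ n → a ℚ.+ (m ℚ.+ z) ℚ.≤ (a ℚ.+ z) ℚ.+ (m ℚ.+ n)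
    bound a m z n 0≤n = begin
      a ℚ.+ (m ℚ.+ z)          ≡⟨ solve 3 (λ a m z → a :+ (m :+ z) := (a :+ z) :+ m) refl a m z ⟩
      (a ℚ.+ z) ℚ.+ m          ≡⟨ cong ((a ℚ.+ z) ℚ.+_) (ℚ.+-identityʳ m) ⟨
      (a ℚ.+ z) ℚ.+ (m ℚ.+ 0ℚ) ≤⟨ ℚ.+-monoʳ-≤ (a ℚ.+ z) (ℚ.+-monoʳ-≤ m 0≤n) ⟩
      (a ℚ.+ z) ℚ.+ (m ℚ.+ n)  ∎

  -- x ⊏ y holds exactly when x and y are some δ k apart, which reduces
  -- facts on strict inequalities to facts on weak ones.
  ⊏⇒gap : ∀ {x y} → x ⊏ y → ∃[ k ] x ∔ κ (δ k) ⊑ y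
  ⊏⇒gap {x} {y} (m , n , lt) = proj₁ gap , λ i j →
    gap-ℚ {approx x m} {approx x (half i)} {approx y n} {approx y j} {δ m} {δ n} {δ i} {δ (half i)} {δ j} {δ (proj₁ gap)}
      (regular x (half i) m) (regular y n j) (δ-half-≤ i) (ℚ.<⇒≤ (proj₂ gap))
    where
    gap : ∃[ k ] δ k ℚ.< approx y n ℚ.- (approx x m ℚ.+ (δ m ℚ.+ δ n))
    gap = δ-archimedean _ (p<q⇒0<q-p {approx x m ℚ.+ (δ m ℚ.+ δ n)} {approx y n} lt)

  gap⇒⊏ : ∀ {x y} k → x ∔ κ (δ k) ⊑ y → x ⊏ y
  gap⇒⊏ {x} {y} k p = at (half k) (half (half k)) (δ-half k) (δ-half (half k))
    where
    at : ∀ k′ h → δ k′ ℚ.+ δ k′ ≡ δ k → δ h ℚ.+ δ h ≡ δ k′ → x < y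
    at k′ h eq eq′ = half (half h) , half h ,
      gap-ℚ′ {approx x (half (half h))} {approx y (half h)} {δ (half h)} {δ (half (half h))} {δ h} {δ k′} {δ k}
        (p (half h) (half h)) (δ-half-≤ (half h)) (δ-half h) eq′ eq (0<δ k′)

  ⊏-⊒-absurd : ∀ {x y} → x ⊏ y → ¬ y ⊑ x
  ⊏-⊒-absurd {x} {y} (m , n , lt) p = ℚ.<-irrefl refl (ℚ.<-≤-trans lt
    (subst (λ u → approx y n ℚ.≤ approx x m ℚ.+ u) (ℚ.+-comm (δ n) (δ m)) (p n m)))

  ⊏̸⇒⊒ : ∀ {x y} → ¬ x ⊏ y → y ⊑ x
  ⊏̸⇒⊒ {x} {y} ¬p m n = Dec.decidable-stable (approx y m ℚ.≤? approx x n ℚ.+ (δ m ℚ.+ δ n)) λ ¬q →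
    ¬p (n , m , subst (λ u → approx x n ℚ.+ u ℚ.< approx y m) (ℚ.+-comm (δ m) (δ n)) (ℚ.≰⇒> ¬q))

infix 4 _≈_

-- Equality of reals, as a record so that the reals can be inferred.
record _≈_ (x y : ℝ) : Set where
  constructor _,_
  field
    ≈⇒⊑ : x ⊑ y
    ≈⇒⊒ : y ⊑ x
open _≈_ public

0# : ℝ
0# = κ 0ℚ

-- Passage between the two forms of the relations and operations.
abstract
  ι⊑⇔ : ∀ n x → (fromℕ n ≤ x → ι n ⊑ x) × (ι n ⊑ x → fromℕ n ≤ x)
  ι⊑⇔ _ _ = (λ p → p) , λ p → p

  ι⊏⇔ : ∀ n x → (fromℕ n < x → ι n ⊏ x) × (ι n ⊏ x → fromℕ n < x)
  ι⊏⇔ _ _ = (λ p → p) , λ p → p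

  ⊑ι⇔ : ∀ n x → (x ≤ fromℕ n → x ⊑ ι n) × (x ⊑ ι n → x ≤ fromℕ n)
  ⊑ι⇔ _ _ = (λ p → p) , λ p → p

  ⊏ι⇔ : ∀ n x → (x < fromℕ n → x ⊏ ι n) × (x ⊏ ι n → x < fromℕ n)
  ⊏ι⇔ _ _ = (λ p → p) , λ p → p

  ≃⇒≈ : ∀ x y → x ≃ y → x ≈ y
  ≃⇒≈ _ _ (p , q) = p , q

  ≈⇒≃ : ∀ x y → x ≈ y → x ≃ y
  ≈⇒≃ _ _ (p , q) = p , q

  value-⊕ : ∀ x d → value (x ⊕ d) ≈ value x ∔ value d
  value-⊕ x d = ⊑-refl {value (x ⊕ d)} , ⊑-refl {value (x ⊕ d)}

  value-fromℚ≥0 : ∀ q → value (fromℚ≥0 q) ≈ κ (proj₁ q)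
  value-fromℚ≥0 q = ⊑-refl {κ (proj₁ q)} , ⊑-refl {κ (proj₁ q)}

  0⊑value : ∀ x → 0# ⊑ value x
  0⊑value = nonNegative

  toℝ≥0 : ∀ x → 0# ⊑ x → 0ℝ ≤ x
  toℝ≥0 _ p = p

  0⊏⇒0< : ∀ x → 0# ⊏ x → 0ℝ < x
  0⊏⇒0< _ p = p

≈-refl : ∀ {x} → x ≈ x
≈-refl = ⊑-refl , ⊑-refl

≈-reflexive : ∀ {x y} → x ≡ y → x ≈ y
≈-reflexive refl = ≈-refl

≈-sym : ∀ {x y} → x ≈ y → y ≈ x
≈-sym (p , q) = q , p

≈-trans : ∀ {x y z} → x ≈ y → y ≈ z → x ≈ z
≈-trans (p , q) (p′ , q′) = ⊑-trans p p′ , ⊑-trans q′ q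

∔-cong : ∀ {x y z w} → x ≈ y → z ≈ w → x ∔ z ≈ y ∔ w
∔-cong (p , p′) (q , q′) = ∔-mono-⊑ p q , ∔-mono-⊑ p′ q′

∔-congˡ : ∀ {x y} z → x ≈ y → z ∔ x ≈ z ∔ y
∔-congˡ z p = ∔-cong (≈-refl {z}) p

∔-congʳ : ∀ {x y} z → x ≈ y → x ∔ z ≈ y ∔ z
∔-congʳ z p = ∔-cong p (≈-refl {z})

∔-comm : ∀ x y → x ∔ y ≈ y ∔ x
∔-comm x y = ∔-comm-⊑ x y , ∔-comm-⊑ y x

∔-assoc : ∀ x y z → (x ∔ y) ∔ z ≈ x ∔ (y ∔ z)
∔-assoc x y z = ∔-assoc-⊑ x y z ,
  ⊑-trans (∔-comm-⊑ x (y ∔ z))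
  (⊑-trans (∔-mono-⊑ (∔-comm-⊑ y z) ⊑-refl)
  (⊑-trans (∔-assoc-⊑ z y x)
  (⊑-trans (∔-comm-⊑ z (y ∔ x))
  (∔-mono-⊑ (∔-comm-⊑ y x) ⊑-refl))))

∔-identityʳ : ∀ x → x ∔ 0# ≈ x
∔-identityʳ x = ∔-identityʳ-⊑ x , ∔-identityʳ-⊒ x

∔-inverseʳ : ∀ x → x ∔ ⊖ x ≈ 0#
∔-inverseʳ x = ∔-inverseʳ-⊑ x , ∔-inverseʳ-⊒ x

κ-∔ : ∀ p q → κ (p ℚ.+ q) ≈ κ p ∔ κ q
κ-∔ p q = κ-∔-⊑ p q , κ-∔-⊒ p q

∔-commutativeMonoid : CommutativeMonoid _ _
∔-commutativeMonoid = record
  { Carrier = ℝ ; _≈_ = _≈_ ; _∙_ = _∔_ ; ε = 0#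
  ; isCommutativeMonoid = record
    { isMonoid = record
      { isSemigroup = record
        { isMagma = record
          { isEquivalence = record { refl = ≈-refl ; sym = ≈-sym ; trans = ≈-trans }
          ; ∙-cong = ∔-cong
          }
        ; assoc = ∔-assoc
        }
      ; identity = (λ x → ≈-trans (∔-comm 0# x) (∔-identityʳ x)) , ∔-identityʳ
      }
    ; comm = ∔-comm
    }
  }

open CommutativeMonoidSolver ∔-commutativeMonoid using (_⊜_) renaming (solve to solve⊞; _⊕_ to _⊞_)

∔-cancelʳ-⊑ : ∀ {x y} z → x ∔ z ⊑ y ∔ z → x ⊑ y
∔-cancelʳ-⊑ {x} {y} z p =
  ⊑-trans (≈⇒⊒ (drop x)) (⊑-trans (∔-mono-⊑ p ⊑-refl) (≈⇒⊑ (drop y)))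
  where
  drop : ∀ x → (x ∔ z) ∔ ⊖ z ≈ x
  drop x = ≈-trans (∔-assoc x z (⊖ z)) (≈-trans (∔-congˡ x (∔-inverseʳ z)) (∔-identityʳ x))

∔-cancelʳ : ∀ {x y} z → x ∔ z ≈ y ∔ z → x ≈ y
∔-cancelʳ z (p , q) = ∔-cancelʳ-⊑ z p , ∔-cancelʳ-⊑ z q

-- The difference y - x, as the solution of an equation.
_∸_ : ∀ y x → ∃[ d ] d ∔ x ≈ y
y ∸ x = y ∔ ⊖ x , ≈-trans (∔-assoc y (⊖ x) x)
  (≈-trans (∔-congˡ y (≈-trans (∔-comm (⊖ x) x) (∔-inverseʳ x))) (∔-identityʳ y))

⊏-⊑-trans : ∀ {x y z} → x ⊏ y → y ⊑ z → x ⊏ z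
⊏-⊑-trans p q = let k , r = ⊏⇒gap p in gap⇒⊏ k (⊑-trans r q)

⊑-⊏-trans : ∀ {x y z} → x ⊑ y → y ⊏ z → x ⊏ z
⊑-⊏-trans p q = let k , r = ⊏⇒gap q in gap⇒⊏ k (⊑-trans (∔-mono-⊑ p ⊑-refl) r)

⊏⇒⊑ : ∀ {x y} → x ⊏ y → x ⊑ y
⊏⇒⊑ {x} p = let k , r = ⊏⇒gap p in
  ⊑-trans (⊑-trans (≈⇒⊒ (∔-identityʳ x)) (∔-mono-⊑ ⊑-refl (κ-mono (0≤δ k)))) r

⊏-irrefl : ∀ {x} → ¬ x ⊏ x
⊏-irrefl p = ⊏-⊒-absurd p ⊑-refl

⊏-trans : ∀ {x y z} → x ⊏ y → y ⊏ z → x ⊏ z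
⊏-trans p q = ⊏-⊑-trans p (⊏⇒⊑ q)

⊑-isPreorder : IsPreorder _≈_ _⊑_
⊑-isPreorder = record
  { isEquivalence = CommutativeMonoid.isEquivalence ∔-commutativeMonoid
  ; reflexive = ≈⇒⊑
  ; trans = ⊑-trans
  }

⊏-asym : Asymmetric _⊏_
⊏-asym p q = ⊏-irrefl (⊏-trans p q)

⊏-resp-≈ : _⊏_ Respects₂ _≈_
⊏-resp-≈ = (λ p q → ⊏-⊑-trans q (≈⇒⊑ p)) , λ p q → ⊑-⊏-trans (≈⇒⊒ p) q

module ℝ-Reasoning = Relation.Binary.Reasoning.Base.Triple
  ⊑-isPreorder ⊏-asym ⊏-trans ⊏-resp-≈ ⊏⇒⊑ ⊏-⊑-trans ⊑-⊏-trans

∔-monoˡ-⊏ : ∀ {x y} z → x ⊏ y → x ∔ z ⊏ y ∔ z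
∔-monoˡ-⊏ {x} {y} z p = let k , r = ⊏⇒gap p in gap⇒⊏ k (begin
  (x ∔ z) ∔ κ (δ k) ≈⟨ solve⊞ 3 (λ x z k → (x ⊞ z) ⊞ k ⊜ (x ⊞ k) ⊞ z) ≈-refl x z (κ (δ k)) ⟩
  (x ∔ κ (δ k)) ∔ z ≤⟨ ∔-mono-⊑ r ⊑-refl ⟩
  y ∔ z          ∎)
  where
  open ℝ-Reasoning

∔-monoʳ-⊏ : ∀ {x y} z → x ⊏ y → z ∔ x ⊏ z ∔ y
∔-monoʳ-⊏ {x} {y} z p = ⊑-⊏-trans (≈⇒⊑ (∔-comm z x)) (⊏-⊑-trans (∔-monoˡ-⊏ z p) (≈⇒⊑ (∔-comm y z)))

∔-cancelʳ-⊏ : ∀ {x y} z → x ∔ z ⊏ y ∔ z → x ⊏ y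
∔-cancelʳ-⊏ {x} {y} z p = let k , r = ⊏⇒gap p in gap⇒⊏ k (∔-cancelʳ-⊑ z (begin
  (x ∔ κ (δ k)) ∔ z ≈⟨ solve⊞ 3 (λ x z k → (x ⊞ k) ⊞ z ⊜ (x ⊞ z) ⊞ k) ≈-refl x z (κ (δ k)) ⟩
  (x ∔ z) ∔ κ (δ k) ≤⟨ r ⟩
  y ∔ z          ∎))
  where open ℝ-Reasoning

κ-mono-⊏ : ∀ {p q} → p ℚ.< q → κ p ⊏ κ q
κ-mono-⊏ {p} {q} p<q = let k , δk< = δ-archimedean (q ℚ.- p) 0<q-p in gap⇒⊏ k
  (⊑-trans (≈⇒⊒ (κ-∔ p (δ k))) (κ-mono (begin
    p ℚ.+ δ k       ≤⟨ ℚ.+-monoʳ-≤ p (ℚ.<⇒≤ δk<) ⟩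
    p ℚ.+ (q ℚ.- p) ≡⟨ solve 2 (λ p q → p :+ (q :- p) := q) refl p q ⟩
    q               ∎)))
  where
  open ℚ.≤-Reasoning
  open +-*-Solver
  0<q-p : 0ℚ ℚ.< q ℚ.- p
  0<q-p = subst (ℚ._< q ℚ.- p) (ℚ.+-inverseʳ p) (ℚ.+-monoˡ-< (ℚ.- p) p<q)

-- Between x and y there is room for a positive shift.
⊏-room : ∀ {x y} → x ⊏ y → ∃[ d ] 0# ⊏ d × x ∔ d ⊏ y
⊏-room {x} {y} p = let k , r = ⊏⇒gap p; h = half k in
  κ (δ h) , κ-mono-⊏ (0<δ h) , gap⇒⊏ h (begin
    (x ∔ κ (δ h)) ∔ κ (δ h) ≈⟨ ∔-assoc x (κ (δ h)) (κ (δ h)) ⟩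
    x ∔ (κ (δ h) ∔ κ (δ h)) ≈⟨ ∔-congˡ x (κ-∔ (δ h) (δ h)) ⟨
    x ∔ κ (δ h ℚ.+ δ h) ≡⟨ cong (λ q → x ∔ κ q) (δ-half k) ⟩
    x ∔ κ (δ k) ≤⟨ r ⟩
    y ∎)
  where open ℝ-Reasoning

⊏-dense : ∀ {x y} → x ⊏ y → ∃[ z ] x ⊏ z × z ⊏ y
⊏-dense {x} p = let d , 0<d , r = ⊏-room p in
  x ∔ d , ⊑-⊏-trans (≈⇒⊒ (∔-identityʳ x)) (∔-monoʳ-⊏ x 0<d) , r

------------------------------------------------------------------------
-- Natural numbers among the reals

ι-zero : ι 0 ≡ 0#
ι-zero = ι≡κ 0

1ℝ : ℝ
1ℝ = ι 1

ι-suc : ∀ n → ι (suc n) ≈ ι n ∔ 1ℝ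
ι-suc n = ≈-trans (≈-reflexive (trans (ι≡κ (suc n)) (cong κ suc-ℚ)))
  (≈-trans (κ-∔ (+ n ℚ./ 1) (+ 1 ℚ./ 1)) (≈-reflexive (sym (cong₂ _∔_ (ι≡κ n) (ι≡κ 1)))))
  where
  suc-ℚ : + suc n ℚ./ 1 ≡ + n ℚ./ 1 ℚ.+ + 1 ℚ./ 1
  suc-ℚ = ℚ.toℚᵘ-injective (begin
    ℚ.toℚᵘ (+ suc n ℚ./ 1)
      ≈⟨ ℚ.toℚᵘ-fromℚᵘ (mkℚᵘ (+ suc n) 0) ⟩
    mkℚᵘ (+ suc n) 0
      ≈⟨ ℚᵘ.*≡* cross ⟩
    mkℚᵘ (+ n) 0 ℚᵘ.+ mkℚᵘ (+ 1) 0
      ≈⟨ ℚᵘ.+-cong (ℚ.toℚᵘ-fromℚᵘ (mkℚᵘ (+ n) 0)) (ℚ.toℚᵘ-fromℚᵘ (mkℚᵘ (+ 1) 0)) ⟨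
    ℚ.toℚᵘ (+ n ℚ./ 1) ℚᵘ.+ ℚ.toℚᵘ (+ 1 ℚ./ 1)
      ≈⟨ ℚ.toℚᵘ-homo-+ (+ n ℚ./ 1) (+ 1 ℚ./ 1) ⟨
    ℚ.toℚᵘ (+ n ℚ./ 1 ℚ.+ + 1 ℚ./ 1) ∎)
    where
    open ℚᵘ.≃-Reasoning
    cross : + suc n ℤ.* + 1 ≡ (+ n ℤ.* + 1 ℤ.+ + 1 ℤ.* + 1) ℤ.* + 1
    cross = trans (ℤ.*-identityʳ (+ suc n)) (sym (trans (ℤ.*-identityʳ _)
      (trans (cong (ℤ._+ + 1) (ℤ.*-identityʳ (+ n))) (cong +_ (ℕ.+-comm n 1)))))

0⊏1 : 0# ⊏ 1ℝ
0⊏1 = subst (0# ⊏_) (sym (ι≡κ 1)) (κ-mono-⊏ (ℚ.*<* (ℤ.+<+ (s≤s z≤n))))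

⊏-ι-suc : ∀ n → ι n ⊏ ι (suc n)
⊏-ι-suc n = ⊏-⊑-trans (⊑-⊏-trans (≈⇒⊒ (∔-identityʳ (ι n))) (∔-monoʳ-⊏ (ι n) 0⊏1))
  (≈⇒⊒ (ι-suc n))

ι-mono-⊑ : ∀ {m n} → m ℕ.≤ n → ι m ⊑ ι n
ι-mono-⊑ m≤n = go (ℕ.≤⇒≤′ m≤n)
  where
  go : ∀ {m n} → m ℕ.≤′ n → ι m ⊑ ι n
  go (ℕ.≤′-reflexive refl) = ⊑-refl
  go (ℕ.≤′-step {n} p)         = ⊑-trans (go p) (⊏⇒⊑ (⊏-ι-suc n))

ι-mono-⊏ : ∀ {m n} → m ℕ.< n → ι m ⊏ ι n
ι-mono-⊏ {m} m<n = ⊏-⊑-trans (⊏-ι-suc m) (ι-mono-⊑ m<n)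

-- Opaque, so that it is not evaluated.
abstract
  ceiling : ∀ q → ∃[ n ] q ℚ.≤ + n ℚ./ 1
  ceiling (mkℚ i d _) = ℤ.∣ i ∣ , ℚ.toℚᵘ-cancel-≤ (ℚᵘ.≤-respʳ-≃ (ℚᵘ.≃-sym (ℚ.toℚᵘ-fromℚᵘ (mkℚᵘ (+ ℤ.∣ i ∣) 0)))
    (ℚᵘ.*≤* (bound i d)))
    where
    bound : ∀ i d → i ℤ.* + 1 ℤ.≤ + ℤ.∣ i ∣ ℤ.* + suc d
    bound (+ n)    d = subst (ℤ._≤ + n ℤ.* + suc d) (sym (ℤ.*-identityʳ (+ n)))
      (subst (+ n ℤ.≤_) (ℤ.pos-* n (suc d)) (ℤ.+≤+ (ℕ.m≤m*n n (suc d))))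
    bound -[1+ n ] d = subst (-[1+ n ] ℤ.* + 1 ℤ.≤_) (ℤ.pos-* (suc n) (suc d)) ℤ.-≤+

archimedean : ∀ x → ∃[ n ] x ⊑ ι n
archimedean x = let n , le = ceiling (approx x 0 ℚ.+ δ 0) in
  n , subst (x ⊑_) (sym (ι≡κ n)) (⊑-trans (κ-bound x) (κ-mono le))

------------------------------------------------------------------------
-- Comparisons, decided or up to double negation

open RawMonad (¬¬-Monad {0ℓ}) using (_>>=_) renaming (pure to return)

-- The three possible outcomes of a comparison.
Tri : ℝ → ℝ → Set
Tri x y = x ⊏ y ⊎ x ≈ y ⊎ y ⊏ x

¬¬-tri : ∀ x y → ¬ ¬ Tri x y
¬¬-tri x y = ¬¬-excluded-middle {A = x ⊏ y} >>= λ where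
  (yes p) → return (inj₁ p)
  (no ¬p) → ¬¬-excluded-middle {A = y ⊏ x} >>= λ where
    (yes q) → return (inj₂ (inj₂ q))
    (no ¬q) → return (inj₂ (inj₁ (⊏̸⇒⊒ ¬q , ⊏̸⇒⊒ ¬p)))

¬¬-All : ∀ {A : Set} {P : A → Set} → (∀ x → ¬ ¬ P x) → ∀ xs → ¬ ¬ All P xs
¬¬-All p []       = return []
¬¬-All p (x ∷ xs) = p x >>= λ px → ¬¬-All p xs >>= λ pxs → return (px ∷ pxs)

tri-ℚ : ∀ p q → Tri (κ p) (κ q)
tri-ℚ p q with ℚ.<-cmp p q
... | tri< p<q _ _ = inj₁ (κ-mono-⊏ p<q)
... | tri≈ _ refl _ = inj₂ (inj₁ ≈-refl)
... | tri> _ _ q<p = inj₂ (inj₂ (κ-mono-⊏ q<p))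

-- The integer part of a real that can be compared with the naturals up
-- to an upper bound N.
floor : ∀ {x} N → 0# ⊑ x → x ⊏ ι N → All (λ n → Tri x (ι n)) (upTo N) →
  ∃[ m ] ι m ⊑ x × x ⊏ ι (suc m)
floor zero    0≤x x<N _ = contradiction 0≤x (⊏-⊒-absurd (⊏-⊑-trans x<N (≈⇒⊑ (≈-reflexive ι-zero))))
floor {x} (suc N) 0≤x x<N tri with All.lookup tri (Mem.∈-upTo⁺ (ℕ.n<1+n N))
... | inj₁ p        = floor N 0≤x p (All.tabulate λ m → All.lookup tri (Mem.∈-upTo⁺ (ℕ.m<n⇒m<1+n (Mem.∈-upTo⁻ m))))
... | inj₂ (inj₁ p) = N , ≈⇒⊒ p , x<N
... | inj₂ (inj₂ p) = N , ⊏⇒⊑ p , x<N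

------------------------------------------------------------------------
-- The system of regions

-- Where the fractional part of an age lies: at 0 or strictly above.
data Phase : Set where
  integral fractional : Phase

-- Membership in an interval of an age with integer part n, in terms of n
-- and of the phase.
AdmitsLower : Phase → ℕ → LowerBound → Set
AdmitsLower _          n (closed a) = a ℕ.≤ n
AdmitsLower integral   n (strict a) = a ℕ.< n
AdmitsLower fractional n (strict a) = a ℕ.≤ n

AdmitsUpper : Phase → ℕ → UpperBound → Set
AdmitsUpper integral   n (closed b) = n ℕ.≤ b
AdmitsUpper fractional n (closed b) = n ℕ.< b
AdmitsUpper _          n (strict b) = n ℕ.< b
AdmitsUpper _          n ∞          = ⊤

Admits : Phase → ℕ → Interval → Set
Admits φ n I = AdmitsLower φ n (Interval.lower I) × AdmitsUpper φ n (Interval.upper I)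

admitsLower? : ∀ φ n L → Dec (AdmitsLower φ n L)
admitsLower? integral   n (closed a) = a ℕ.≤? n
admitsLower? fractional n (closed a) = a ℕ.≤? n
admitsLower? integral   n (strict a) = a ℕ.<? n
admitsLower? fractional n (strict a) = a ℕ.≤? n

admitsUpper? : ∀ φ n U → Dec (AdmitsUpper φ n U)
admitsUpper? integral   n (closed b) = n ℕ.≤? b
admitsUpper? fractional n (closed b) = n ℕ.<? b
admitsUpper? integral   n (strict b) = n ℕ.<? b
admitsUpper? fractional n (strict b) = n ℕ.<? b
admitsUpper? integral   n ∞          = yes tt
admitsUpper? fractional n ∞          = yes tt

admits? : ∀ φ n I → Dec (Admits φ n I)
admits? φ n I = admitsLower? φ n (Interval.lower I) ×-dec admitsUpper? φ n (Interval.upper I)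

-- Executing a list of actions in order.
data Sequence {A S : Set} (Act : A → S → S → Set) : List A → S → S → Set where
  []  : ∀ {s} → Sequence Act [] s s
  _∷_ : ∀ {a as s t u} → Act a s t → Sequence Act as t u → Sequence Act (a ∷ as) s u

sequence-listing : ∀ {A S : Set} {Act : A → S → S → Set} →
  (∀ a → Enumerable (Act a)) → ∀ as → Enumerable (Sequence Act as)
sequence-listing act []       s = listing-⇔ (λ { (_ , refl) → [] }) (λ { [] → tt , refl }) (listing-if (yes tt) s)
sequence-listing act (a ∷ as) s = listing-⇔ (λ { (_ , x , xs) → x ∷ xs }) (λ { (x ∷ xs) → _ , x , xs })
  (listing-bind (act a s) (sequence-listing act as))

-- A word cut at one of its letters l.
Splitting : ∀ {A : Set} → List A → List A × A × List A → Set
Splitting ws (us , l , vs) = us ++ l ∷ vs ≡ ws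

splits : ∀ {A : Set} → Enumerable (Splitting {A})
splits         []       = listing-∅ λ { {[] , _} () ; {_ ∷ _ , _} () }
splits {A} (w ∷ ws) = listing-⇔ sound complete
  (listing-⊎ (listing-if (yes tt) ([] , w , ws)) (listing-map grow (splits ws)))
  where
  grow : List A × A × List A → List A × A × List A
  grow (us , l , vs) = w ∷ us , l , vs
  Cases : List A × A × List A → Set
  Cases s = ⊤ × ([] , w , ws) ≡ s ⊎ (∃[ r ] Splitting ws r × grow r ≡ s)
  sound : ∀ {s} → Cases s → Splitting (w ∷ ws) s
  sound (inj₁ (_ , refl))        = refl
  sound (inj₂ (_ , refl , refl)) = refl
  complete : ∀ {s} → Splitting (w ∷ ws) s → Cases s
  complete {[] , _}          refl = inj₁ (tt , refl)
  complete {_ ∷ us , l , vs} refl = inj₂ ((us , l , vs) , refl , refl)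

Sublist-split : ∀ {A : Set} {R : A → A → Set} us {l vs ws} → Sublist R (us ++ l ∷ vs) ws →
  ∃[ us′ ] ∃[ l′ ] ∃[ vs′ ] us′ ++ l′ ∷ vs′ ≡ ws × Sublist R us us′ × R l l′ × Sublist R vs vs′
Sublist-split []       (r ∷ e)  = [] , _ , _ , refl , [] , r , e
Sublist-split []       (w ∷ʳ e) = let us′ , l′ , vs′ , eq , e₁ , r , e₂ = Sublist-split [] e in
  w ∷ us′ , l′ , vs′ , cong (w ∷_) eq , w ∷ʳ e₁ , r , e₂
Sublist-split (u ∷ us) (p ∷ e)  = let us′ , l′ , vs′ , eq , e₁ , r , e₂ = Sublist-split us e in
  _ ∷ us′ , l′ , vs′ , cong (_ ∷_) eq , p ∷ e₁ , r , e₂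
Sublist-split (u ∷ us) (w ∷ʳ e) = let us′ , l′ , vs′ , eq , e₁ , r , e₂ = Sublist-split (u ∷ us) e in
  w ∷ us′ , l′ , vs′ , cong (w ∷_) eq , w ∷ʳ e₁ , r , e₂

module Regions (N : TPN) (K : ℕ) where
  open TPN N

  Arc : Set
  Arc = Place × Interval

  -- A token, known by its place and its integer part capped at K.
  Letter : Set
  Letter = Place × Fin (suc K)

  -- The tokens with a common fractional part.
  Bucket : Set
  Bucket = List Letter

  -- The tokens of fractional part 0, and the buckets of those of positive
  -- fractional part, by increasing fractional part.
  State : Set
  State = Bucket × List Bucket

  total : List Bucket → ℕ
  total ws = sum (map length ws)

  size : State → ℕ
  size (z , ws) = length z ℕ.+ total ws

  -- The integer part m, or K if m is larger.
  cap : ℕ → Fin (suc K)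
  cap m = fromℕ< (s≤s (ℕ.m⊓n≤n m K))

  toℕ-cap : ∀ m → toℕ (cap m) ≡ m ℕ.⊓ K
  toℕ-cap m = Fin.toℕ-fromℕ< (s≤s (ℕ.m⊓n≤n m K))

  -- The integer part has grown by one.
  older : Letter → Letter
  older (p , n) = p , cap (suc (toℕ n))

  -- A token abstracted to the letter may be moved along the arc.
  Fits : Phase → Arc → Letter → Set
  Fits φ (p , I) (q , n) = p ≡ q × Admits φ (toℕ n) I

  -- Removal of a token from a bucket, from some bucket of a list, and from a
  -- state; and addition of one to an old or new bucket, and to a state.
  data Delete (φ : Phase) (a : Arc) : Bucket → Bucket → Set where
    here  : ∀ {x b} → Fits φ a x → Delete φ a (x ∷ b) b
    there : ∀ {x b c} → Delete φ a b c → Delete φ a (x ∷ b) (x ∷ c)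

  data Take⁺ (a : Arc) : List Bucket → List Bucket → Set where
    here  : ∀ {b c ws} → Delete fractional a b c → Take⁺ a (b ∷ ws) (c ∷ ws)
    there : ∀ {b ws vs} → Take⁺ a ws vs → Take⁺ a (b ∷ ws) (b ∷ vs)

  data Put⁺ (a : Arc) : List Bucket → List Bucket → Set where
    new   : ∀ {x ws} → Fits fractional a x → Put⁺ a ws ((x ∷ []) ∷ ws)
    here  : ∀ {x b ws} → Fits fractional a x → Put⁺ a (b ∷ ws) ((x ∷ b) ∷ ws)
    there : ∀ {b ws vs} → Put⁺ a ws vs → Put⁺ a (b ∷ ws) (b ∷ vs)

  data Take (a : Arc) : State → State → Set where
    integral   : ∀ {z y ws} → Delete integral a z y → Take a (z , ws) (y , ws)
    fractional : ∀ {z ws vs} → Take⁺ a ws vs → Take a (z , ws) (z , vs)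

  data Put (a : Arc) : State → State → Set where
    integral   : ∀ {x z ws} → Fits integral a x → Put a (z , ws) (x ∷ z , ws)
    fractional : ∀ {z ws vs} → Put⁺ a ws vs → Put a (z , ws) (z , vs)

  -- Time elapses by one unit, or by so little that the only change is that the
  -- integral tokens become fractional, or until the tokens of some bucket l
  -- become integral, those of greater fractional part having passed an
  -- integer; or a transition fires.
  data _⟶_ : State → State → Set where
    unit  : ∀ {z ws} → (z , ws) ⟶ (map older z , map (map older) ws)
    drift : ∀ {z ws} → (z , ws) ⟶ ([] , z ∷ ws)
    wrap  : ∀ {z} us {l vs} → (z , us ++ l ∷ vs) ⟶ (map older l , map (map older) vs ++ z ∷ us)
    fire  : ∀ {s t u} τ → Sequence Take (arcs N (In τ)) s t → Sequence Put (arcs N (Out τ)) t u → s ⟶ u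

  NonEmpty : Bucket → Set
  NonEmpty b = 1 ℕ.≤ length b

  nonEmpty? : Unary.Decidable NonEmpty
  nonEmpty? b = 1 ℕ.≤? length b

  clean : State → State
  clean (z , ws) = z , filter nonEmpty? ws

  Clean : State → Set
  Clean (_ , ws) = All NonEmpty ws

  -- Empty buckets are dropped after every step: between states without them,
  -- s ≼ t with equal sizes implies s ≡ t.
  _⇒_ : State → State → Set
  s ⇒ t = ∃[ u ] s ⟶ u × clean u ≡ t

  clean-Clean : ∀ s → Clean (clean s)
  clean-Clean (_ , ws) = All.all-filter nonEmpty? ws

  ⇒-Clean : ∀ {s t} → s ⇒ t → Clean t
  ⇒-Clean (u , _ , refl) = clean-Clean u

  _≟ₛ_ : DecidableEquality State
  _≟ₛ_ = Product.≡-dec _≟ᵇ_ (List.≡-dec _≟ᵇ_)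
    where
    _≟ᵇ_ : DecidableEquality Bucket
    _≟ᵇ_ = List.≡-dec (Product.≡-dec Fin._≟_ Fin._≟_)

  -- Successors can be listed.

  fits-listing : ∀ φ a → Listing (Fits φ a)
  fits-listing φ (p , I) = listing-⇔
    (λ { (n , _ , adm , refl) → refl , adm })
    (λ { {_ , n} (refl , adm) → n , tt , adm , refl })
    (listing-bind listing-Fin λ n → listing-if (admits? φ (toℕ n) I) (p , n))

  fits? : ∀ φ a x → Dec (Fits φ a x)
  fits? φ (p , I) (q , n) = p Fin.≟ q ×-dec admits? φ (toℕ n) I

  delete-listing : ∀ φ a → Enumerable (Delete φ a)
  delete-listing φ a []      = listing-∅ λ ()
  delete-listing φ a (x ∷ b) = listing-⇔
    (λ { (inj₁ (f , refl)) → here f ; (inj₂ (_ , d , refl)) → there d })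
    (λ { (here f) → inj₁ (f , refl) ; (there d) → inj₂ (_ , d , refl) })
    (listing-⊎ (listing-if (fits? φ a x) b) (listing-map (x ∷_) (delete-listing φ a b)))

  take⁺-listing : ∀ a → Enumerable (Take⁺ a)
  take⁺-listing a []       = listing-∅ λ ()
  take⁺-listing a (b ∷ ws) = listing-⇔
    (λ { (inj₁ (_ , d , refl)) → here d ; (inj₂ (_ , d , refl)) → there d })
    (λ { (here d) → inj₁ (_ , d , refl) ; (there d) → inj₂ (_ , d , refl) })
    (listing-⊎ (listing-map (_∷ ws) (delete-listing fractional a b)) (listing-map (b ∷_) (take⁺-listing a ws)))

  put⁺-listing : ∀ a → Enumerable (Put⁺ a)
  put⁺-listing a []       = listing-⇔
    (λ { (_ , f , refl) → new f })
    (λ { (new f) → _ , f , refl })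
    (listing-map (λ x → (x ∷ []) ∷ []) (fits-listing fractional a))
  put⁺-listing a (b ∷ ws) = listing-⇔
    (λ { (inj₁ (_ , f , refl)) → new f ; (inj₂ (inj₁ (_ , f , refl))) → here f ; (inj₂ (inj₂ (_ , p , refl))) → there p })
    (λ { (new f) → inj₁ (_ , f , refl) ; (here f) → inj₂ (inj₁ (_ , f , refl)) ; (there p) → inj₂ (inj₂ (_ , p , refl)) })
    (listing-⊎ (listing-map (λ x → (x ∷ []) ∷ b ∷ ws) (fits-listing fractional a))
    (listing-⊎ (listing-map (λ x → (x ∷ b) ∷ ws) (fits-listing fractional a))
               (listing-map (b ∷_) (put⁺-listing a ws))))

  take-listing : ∀ a → Enumerable (Take a)
  take-listing a (z , ws) = listing-⇔
    (λ { (inj₁ (_ , d , refl)) → integral d ; (inj₂ (_ , d , refl)) → fractional d })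
    (λ { (integral d) → inj₁ (_ , d , refl) ; (fractional d) → inj₂ (_ , d , refl) })
    (listing-⊎ (listing-map (_, ws) (delete-listing integral a z)) (listing-map (z ,_) (take⁺-listing a ws)))

  put-listing : ∀ a → Enumerable (Put a)
  put-listing a (z , ws) = listing-⇔
    (λ { (inj₁ (_ , d , refl)) → integral d ; (inj₂ (_ , d , refl)) → fractional d })
    (λ { (integral d) → inj₁ (_ , d , refl) ; (fractional d) → inj₂ (_ , d , refl) })
    (listing-⊎ (listing-map (λ x → x ∷ z , ws) (fits-listing integral a)) (listing-map (z ,_) (put⁺-listing a ws)))

  ⟶-listing : Enumerable _⟶_
  ⟶-listing (z , ws) = listing-⇔
    (λ { (inj₁ (_ , refl)) → unit
       ; (inj₂ (inj₁ (_ , refl))) → drift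
       ; (inj₂ (inj₂ (inj₁ ((us , _ , _) , refl , refl)))) → wrap us
       ; (inj₂ (inj₂ (inj₂ (τ , _ , _ , takes , puts)))) → fire τ takes puts })
    (λ { unit → inj₁ (tt , refl)
       ; drift → inj₂ (inj₁ (tt , refl))
       ; (wrap us) → inj₂ (inj₂ (inj₁ (_ , refl , refl)))
       ; (fire τ takes puts) → inj₂ (inj₂ (inj₂ (τ , tt , _ , takes , puts))) })
    (listing-⊎ (listing-if (yes tt) (map older z , map (map older) ws))
    (listing-⊎ (listing-if (yes tt) ([] , z ∷ ws))
    (listing-⊎ (listing-map (λ (us , l , vs) → map older l , map (map older) vs ++ z ∷ us) (splits ws))
    (listing-bind listing-Fin λ τ → listing-bind
      (sequence-listing take-listing (arcs N (In τ)) (z , ws))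
      (sequence-listing put-listing (arcs N (Out τ)))))))

  successors : Enumerable _⇒_
  successors s = listing-map clean (⟶-listing s)

  -- The order on states: tokens may be added, without merging buckets.

  _≼ᵇ_ : Bucket → Bucket → Set
  _≼ᵇ_ = Sublist _≡_

  _≼_ : State → State → Set
  (z , ws) ≼ (y , vs) = z ≼ᵇ y × Sublist _≼ᵇ_ ws vs

  ≼-af : AlmostFull _≼_
  ≼-af = af-∩ (af-on proj₁ bucket-af) (af-on proj₂ (higman (Sublist.sublist? letter?) bucket-af))
    where
    letter? : DecidableEquality Letter
    letter? = Product.≡-dec Fin._≟_ Fin._≟_
    bucket-af : AlmostFull _≼ᵇ_
    bucket-af = higman letter? (af-× af-Fin af-Fin)

  total-++ : ∀ us vs → total (us ++ vs) ≡ total us ℕ.+ total vs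
  total-++ us vs = trans (cong sum (List.map-++ length us vs)) (sum-++ (map length us) (map length vs))

  ≼ᵇ-length : ∀ {b c} → b ≼ᵇ c → length b ℕ.< length c ⊎ b ≡ c
  ≼ᵇ-length e with ℕ.m≤n⇒m<n∨m≡n (Sublist.length-mono-≤ e)
  ... | inj₁ lt = inj₁ lt
  ... | inj₂ eq = inj₂ (Pointwise.Pointwise-≡⇒≡ (Sublist.toPointwise eq e))

  <⊎≡-+ : ∀ {A B : Set} {a a′ : A} {b b′ : B} {m m′ n n′} → (m ℕ.< m′ ⊎ a ≡ a′) → m ℕ.≤ m′ →
    (n ℕ.< n′ ⊎ b ≡ b′) → n ℕ.≤ n′ → m ℕ.+ n ℕ.< m′ ℕ.+ n′ ⊎ (a ≡ a′ × b ≡ b′)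
  <⊎≡-+ (inj₁ lt)   _ _           n≤ = inj₁ (ℕ.+-mono-<-≤ lt n≤)
  <⊎≡-+ (inj₂ refl) m≤ (inj₁ lt)   _ = inj₁ (ℕ.+-mono-≤-< m≤ lt)
  <⊎≡-+ (inj₂ refl) _ (inj₂ refl)  _ = inj₂ (refl , refl)

  total-mono : ∀ {ws vs} → Sublist _≼ᵇ_ ws vs → total ws ℕ.≤ total vs
  total-mono []       = z≤n
  total-mono (v ∷ʳ e) = ℕ.m≤n⇒m≤o+n (length v) (total-mono e)
  total-mono (p ∷ e)  = ℕ.+-mono-≤ (Sublist.length-mono-≤ p) (total-mono e)

  total-mono-< : ∀ {ws vs} → All NonEmpty vs → Sublist _≼ᵇ_ ws vs → total ws ℕ.< total vs ⊎ ws ≡ vs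
  total-mono-< []       []       = inj₂ refl
  total-mono-< (n ∷ ns) (v ∷ʳ e) = inj₁ (ℕ.+-mono-≤ n (total-mono e))
  total-mono-< (n ∷ ns) (p ∷ e)  = Sum.map₂ (λ (q , r) → cong₂ _∷_ q r)
    (<⊎≡-+ (≼ᵇ-length p) (Sublist.length-mono-≤ p) (total-mono-< ns e) (total-mono e))

  ≼-size : ∀ {s t} → Clean s → Clean t → s ≼ t → size s ℕ.< size t ⊎ s ≡ t
  ≼-size _ ns (p , e) = Sum.map₂ (λ (q , r) → cong₂ _,_ q r)
    (<⊎≡-+ (≼ᵇ-length p) (Sublist.length-mono-≤ p) (total-mono-< ns e) (total-mono e))

  total-clean : ∀ ws → total (filter nonEmpty? ws) ≡ total ws
  total-clean []             = refl
  total-clean ([] ∷ ws)      = total-clean ws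
  total-clean ((x ∷ b) ∷ ws) = cong (suc (length b) ℕ.+_) (total-clean ws)

  clean-size : ∀ s → size (clean s) ≡ size s
  clean-size (z , ws) = cong (length z ℕ.+_) (total-clean ws)

  clean-≼ : ∀ {s t} → s ≼ t → clean s ≼ clean t
  clean-≼ (p , e) = p , Sublist.⊆-filter-Sublist nonEmpty? nonEmpty? (λ q n → ℕ.≤-trans n (Sublist.length-mono-≤ q)) e

  -- Larger states simulate smaller ones.

  delete-simulate : ∀ {φ a b c b′} → b ≼ᵇ b′ → Delete φ a b c → ∃[ c′ ] Delete φ a b′ c′ × c ≼ᵇ c′
  delete-simulate (y ∷ʳ e)    d         = let c′ , d′ , e′ = delete-simulate e d in y ∷ c′ , there d′ , y ∷ʳ e′
  delete-simulate (refl ∷ e)  (here f)  = _ , here f , e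
  delete-simulate (refl ∷ e)  (there d) = let c′ , d′ , e′ = delete-simulate e d in _ ∷ c′ , there d′ , refl ∷ e′

  take⁺-simulate : ∀ {a ws vs ws′} → Sublist _≼ᵇ_ ws ws′ → Take⁺ a ws vs → ∃[ vs′ ] Take⁺ a ws′ vs′ × Sublist _≼ᵇ_ vs vs′
  take⁺-simulate (b ∷ʳ e) d         = let vs′ , d′ , e′ = take⁺-simulate e d in b ∷ vs′ , there d′ , b ∷ʳ e′
  take⁺-simulate (p ∷ e)  (here d)  = let c′ , d′ , p′ = delete-simulate p d in c′ ∷ _ , here d′ , p′ ∷ e
  take⁺-simulate (p ∷ e)  (there d) = let vs′ , d′ , e′ = take⁺-simulate e d in _ ∷ vs′ , there d′ , p ∷ e′

  -- A token put into a bucket of the smaller list goes to the bucket matched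
  -- with it; a new bucket is created in the place corresponding to it.
  put⁺-simulate : ∀ {a ws vs ws′} → Sublist _≼ᵇ_ ws ws′ → Put⁺ a ws vs → ∃[ vs′ ] Put⁺ a ws′ vs′ × Sublist _≼ᵇ_ vs vs′
  put⁺-simulate e        (new f)   = _ , new f , (refl ∷ []) ∷ e
  put⁺-simulate (b ∷ʳ e) (here f)  = let vs′ , d′ , e′ = put⁺-simulate e (here f) in b ∷ vs′ , there d′ , b ∷ʳ e′
  put⁺-simulate (b ∷ʳ e) (there d) = let vs′ , d′ , e′ = put⁺-simulate e (there d) in b ∷ vs′ , there d′ , b ∷ʳ e′
  put⁺-simulate (p ∷ e)  (here f)  = _ , here f , (refl ∷ p) ∷ e
  put⁺-simulate (p ∷ e)  (there d) = let vs′ , d′ , e′ = put⁺-simulate e d in _ ∷ vs′ , there d′ , p ∷ e′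

  Simulates : (State → State → Set) → Set
  Simulates R = ∀ {s t s′} → s ≼ t → R s s′ → ∃[ t′ ] R t t′ × s′ ≼ t′

  take-simulate : ∀ {a} → Simulates (Take a)
  take-simulate (p , e) (integral d)   = let _ , d′ , p′ = delete-simulate p d in _ , integral d′ , (p′ , e)
  take-simulate (p , e) (fractional d) = let _ , d′ , e′ = take⁺-simulate e d in _ , fractional d′ , (p , e′)

  put-simulate : ∀ {a} → Simulates (Put a)
  put-simulate (p , e) (integral f)   = _ , integral f , (refl ∷ p , e)
  put-simulate (p , e) (fractional d) = let _ , d′ , e′ = put⁺-simulate e d in _ , fractional d′ , (p , e′)

  sequence-simulate : ∀ {Act : Arc → State → State → Set} → (∀ {a} → Simulates (Act a)) → ∀ {as} → Simulates (Sequence Act as)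
  sequence-simulate act s≼t []       = _ , [] , s≼t
  sequence-simulate act s≼t (x ∷ xs) =
    let _ , x′ , s′≼t′ = act s≼t x
        _ , xs′ , s″≼t″ = sequence-simulate act s′≼t′ xs
    in _ , x′ ∷ xs′ , s″≼t″

  delete-length : ∀ {φ a b c} → Delete φ a b c → length b ≡ suc (length c)
  delete-length (here _)  = refl
  delete-length (there d) = cong suc (delete-length d)

  take⁺-total : ∀ {a ws vs} → Take⁺ a ws vs → total ws ≡ suc (total vs)
  take⁺-total (here {ws = ws} d)  = cong (ℕ._+ total ws) (delete-length d)
  take⁺-total (there {b} d)       = trans (cong (length b ℕ.+_) (take⁺-total d)) (ℕ.+-suc (length b) _)

  put⁺-total : ∀ {a ws vs} → Put⁺ a ws vs → total vs ≡ suc (total ws)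
  put⁺-total (new _)       = refl
  put⁺-total (here _)      = refl
  put⁺-total (there {b} d) = trans (cong (length b ℕ.+_) (put⁺-total d)) (ℕ.+-suc (length b) _)

  take-size : ∀ {a s t} → Take a s t → size s ≡ suc (size t)
  take-size (integral {ws = ws} d)  = cong (ℕ._+ total ws) (delete-length d)
  take-size (fractional {z} d) = trans (cong (length z ℕ.+_) (take⁺-total d)) (ℕ.+-suc (length z) _)

  put-size : ∀ {a s t} → Put a s t → size t ≡ suc (size s)
  put-size (integral _)       = refl
  put-size (fractional {z} d) = trans (cong (length z ℕ.+_) (put⁺-total d)) (ℕ.+-suc (length z) _)

  takes-size : ∀ {as s t} → Sequence Take as s t → size s ≡ length as ℕ.+ size t
  takes-size []       = refl
  takes-size (x ∷ xs) = trans (take-size x) (cong suc (takes-size xs))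

  puts-size : ∀ {as s t} → Sequence Put as s t → size t ≡ length as ℕ.+ size s
  puts-size []                 = refl
  puts-size {a ∷ as} (x ∷ xs) = trans (puts-size xs)
    (trans (cong (length as ℕ.+_) (put-size x)) (ℕ.+-suc (length as) _))

  total-older : ∀ ws → total (map (map older) ws) ≡ total ws
  total-older []       = refl
  total-older (b ∷ ws) = cong₂ ℕ._+_ (List.length-map older b) (total-older ws)

  unit-size : ∀ z ws → size (map older z , map (map older) ws) ≡ size (z , ws)
  unit-size z ws = cong₂ ℕ._+_ (List.length-map older z) (total-older ws)

  wrap-size : ∀ z us l vs → size (map older l , map (map older) vs ++ z ∷ us) ≡ size (z , us ++ l ∷ vs)
  wrap-size z us l vs = begin
    length (map older l) ℕ.+ total (map (map older) vs ++ z ∷ us)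
      ≡⟨ cong₂ ℕ._+_ (List.length-map older l) (total-++ (map (map older) vs) (z ∷ us)) ⟩
    length l ℕ.+ (total (map (map older) vs) ℕ.+ (length z ℕ.+ total us))
      ≡⟨ cong (λ n → length l ℕ.+ (n ℕ.+ (length z ℕ.+ total us))) (total-older vs) ⟩
    length l ℕ.+ (total vs ℕ.+ (length z ℕ.+ total us))
      ≡⟨ shuffle (length l) (total vs) (length z) (total us) ⟩
    length z ℕ.+ (total us ℕ.+ (length l ℕ.+ total vs))
      ≡⟨ cong (length z ℕ.+_) (total-++ us (l ∷ vs)) ⟨
    length z ℕ.+ total (us ++ l ∷ vs) ∎
    where
    open ≡.≡-Reasoning
    shuffle : ∀ a b c d → a ℕ.+ (b ℕ.+ (c ℕ.+ d)) ≡ c ℕ.+ (d ℕ.+ (a ℕ.+ b))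
    shuffle = solve-∀

  older-≼ : ∀ {b c} → b ≼ᵇ c → map older b ≼ᵇ map older c
  older-≼ e = Sublist.map⁺ older older (Sublist.map (cong older) e)

  olders-≼ : ∀ {ws vs} → Sublist _≼ᵇ_ ws vs → Sublist _≼ᵇ_ (map (map older) ws) (map (map older) vs)
  olders-≼ e = Sublist.map⁺ (map older) (map older) (Sublist.map older-≼ e)

  ⟶-simulate : ∀ {s t s′} → s ≼ t → s ⟶ s′ → ∃[ t′ ] t ⟶ t′ × s′ ≼ t′ × size s′ ℕ.+ size t ≡ size s ℕ.+ size t′
  ⟶-simulate {z , ws} {y , vs} (p , e) unit = _ , unit , (older-≼ p , olders-≼ e)
    , cong₂ ℕ._+_ (unit-size z ws) (sym (unit-size y vs))
  ⟶-simulate {z , ws} {y , vs} (p , e) drift = _ , drift , (minimum [] , p ∷ e) , refl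
  ⟶-simulate {z , _} {y , _} (p , e) (wrap us {l} {vs}) with Sublist-split us e
  ... | us′ , l′ , vs′ , refl , e₁ , q , e₂ = _ , wrap us′ , (older-≼ q , Sublist.++⁺ (olders-≼ e₂) (p ∷ e₁))
    , cong₂ ℕ._+_ (wrap-size z us l vs) (sym (wrap-size y us′ l′ vs′))
  ⟶-simulate {s} {t} {s″} s≼t (fire {t = s′} τ takes puts)
    with sequence-simulate take-simulate s≼t takes
  ... | t′ , takes′ , s′≼t′ with sequence-simulate put-simulate s′≼t′ puts
  ... | t″ , puts′ , s″≼t″ = t″ , fire τ takes′ puts′ , s″≼t″ , (begin
    size s″ ℕ.+ size t
      ≡⟨ cong₂ ℕ._+_ (puts-size puts) (takes-size takes′) ⟩
    (out ℕ.+ size s′) ℕ.+ (inp ℕ.+ size t′)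
      ≡⟨ shuffle out (size s′) inp (size t′) ⟩
    (inp ℕ.+ size s′) ℕ.+ (out ℕ.+ size t′)
      ≡⟨ cong₂ ℕ._+_ (takes-size takes) (puts-size puts′) ⟨
    size s ℕ.+ size t″ ∎)
    where
    open ≡.≡-Reasoning
    out = length (arcs N (Out τ))
    inp = length (arcs N (In τ))
    shuffle : ∀ a b c d → (a ℕ.+ b) ℕ.+ (c ℕ.+ d) ≡ (c ℕ.+ b) ℕ.+ (a ℕ.+ d)
    shuffle = solve-∀

  ⇒-simulate : ∀ {s t s′} → s ≼ t → s ⇒ s′ → ∃[ t′ ] t ⇒ t′ × s′ ≼ t′ × size s′ ℕ.+ size t ≡ size s ℕ.+ size t′
  ⇒-simulate {s} {t} s≼t (u , st , refl) with ⟶-simulate s≼t st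
  ... | v , st′ , u≼v , eq = clean v , (v , st′ , refl) , clean-≼ u≼v , (begin
    size (clean u) ℕ.+ size t ≡⟨ cong (ℕ._+ size t) (clean-size u) ⟩
    size u ℕ.+ size t         ≡⟨ eq ⟩
    size s ℕ.+ size v         ≡⟨ cong (size s ℕ.+_) (clean-size v) ⟨
    size s ℕ.+ size (clean v) ∎)
    where open ≡.≡-Reasoning

------------------------------------------------------------------------
-- Ages and intervals

-- An age with integer part m and fractional part f, in the given phase.
FractionIn : Phase → ℝ → Set
FractionIn integral   f = f ≈ 0#
FractionIn fractional f = 0# ⊏ f × f ⊏ 1ℝ

module _ {x f : ℝ} {m : ℕ} (x≈ : x ≈ ι m ∔ f) where

  ι-below : ∀ {φ} → FractionIn φ f → ι m ⊑ x
  ι-below {φ} fr = begin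
    ι m      ≈⟨ ∔-identityʳ (ι m) ⟨
    ι m ∔ 0# ≤⟨ ∔-mono-⊑ ⊑-refl (0⊑f φ fr) ⟩
    ι m ∔ f  ≈⟨ x≈ ⟨
    x        ∎
    where
    open ℝ-Reasoning
    0⊑f : ∀ φ → FractionIn φ f → 0# ⊑ f
    0⊑f integral   eq      = ≈⇒⊒ eq
    0⊑f fractional (p , _) = ⊏⇒⊑ p

  ι-suc-above : ∀ {φ} → FractionIn φ f → x ⊏ ι (suc m)
  ι-suc-above {φ} fr = begin-strict
    x         ≈⟨ x≈ ⟩
    ι m ∔ f   <⟨ ∔-monoʳ-⊏ (ι m) (f⊏1 φ fr) ⟩
    ι m ∔ 1ℝ  ≈⟨ ι-suc m ⟨
    ι (suc m) ∎
    where
    open ℝ-Reasoning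
    f⊏1 : ∀ φ → FractionIn φ f → f ⊏ 1ℝ
    f⊏1 integral   eq      = ⊑-⊏-trans (≈⇒⊑ eq) 0⊏1
    f⊏1 fractional (_ , p) = p

  ι-above : FractionIn integral f → x ⊑ ι m
  ι-above eq = ≈⇒⊑ (≈-trans x≈ (≈-trans (∔-congˡ (ι m) eq) (∔-identityʳ (ι m))))

  ι-strictly-below : FractionIn fractional f → ι m ⊏ x
  ι-strictly-below (p , _) = begin-strict
    ι m      ≈⟨ ∔-identityʳ (ι m) ⟨
    ι m ∔ 0# <⟨ ∔-monoʳ-⊏ (ι m) p ⟩
    ι m ∔ f  ≈⟨ x≈ ⟨
    x        ∎
    where open ℝ-Reasoning

  private
    lower-≤ : ∀ {φ a} → FractionIn φ f → ι a ⊑ x → a ℕ.≤ m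
    lower-≤ fr p = ℕ.≮⇒≥ λ m<a → ⊏-⊒-absurd (ι-suc-above fr) (⊑-trans (ι-mono-⊑ m<a) p)

    upper-< : ∀ {φ b} → FractionIn φ f → x ⊏ ι b → m ℕ.< b
    upper-< fr p = ℕ.≰⇒> λ b≤m → ⊏-⊒-absurd p (⊑-trans (ι-mono-⊑ b≤m) (ι-below fr))

    below-upper : ∀ {φ b} → FractionIn φ f → m ℕ.< b → x ⊏ ι b
    below-upper fr m<b = ⊏-⊑-trans (ι-suc-above fr) (ι-mono-⊑ m<b)

  ∈ˡ⇒Admits : ∀ φ L → FractionIn φ f → x ∈ˡ L → AdmitsLower φ m L
  ∈ˡ⇒Admits φ          (closed a) fr p = lower-≤ {φ} fr (proj₁ (ι⊑⇔ a x) p)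
  ∈ˡ⇒Admits integral   (strict a) fr p = ℕ.≰⇒> λ m≤a →
    ⊏-⊒-absurd (proj₁ (ι⊏⇔ a x) p) (⊑-trans (ι-above fr) (ι-mono-⊑ m≤a))
  ∈ˡ⇒Admits fractional (strict a) fr p = lower-≤ {fractional} fr (⊏⇒⊑ (proj₁ (ι⊏⇔ a x) p))

  Admits⇒∈ˡ : ∀ φ L → FractionIn φ f → AdmitsLower φ m L → x ∈ˡ L
  Admits⇒∈ˡ φ          (closed a) fr a≤m = proj₂ (ι⊑⇔ a x) (⊑-trans (ι-mono-⊑ a≤m) (ι-below {φ} fr))
  Admits⇒∈ˡ integral   (strict a) fr a<m = proj₂ (ι⊏⇔ a x) (⊏-⊑-trans (ι-mono-⊏ a<m) (ι-below {integral} fr))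
  Admits⇒∈ˡ fractional (strict a) fr a≤m = proj₂ (ι⊏⇔ a x) (⊑-⊏-trans (ι-mono-⊑ a≤m) (ι-strictly-below fr))

  ∈ᵘ⇒Admits : ∀ φ U → FractionIn φ f → x ∈ᵘ U → AdmitsUpper φ m U
  ∈ᵘ⇒Admits integral   (closed b) fr p = ℕ.≮⇒≥ λ b<m →
    ⊏-⊒-absurd (ι-mono-⊏ b<m) (⊑-trans (ι-below {integral} fr) (proj₁ (⊑ι⇔ b x) p))
  ∈ᵘ⇒Admits fractional (closed b) fr p = ℕ.≰⇒> λ b≤m →
    ⊏-⊒-absurd (⊑-⊏-trans (ι-mono-⊑ b≤m) (ι-strictly-below fr)) (proj₁ (⊑ι⇔ b x) p)
  ∈ᵘ⇒Admits integral   (strict b) fr p = upper-< {integral} fr (proj₁ (⊏ι⇔ b x) p)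
  ∈ᵘ⇒Admits fractional (strict b) fr p = upper-< {fractional} fr (proj₁ (⊏ι⇔ b x) p)
  ∈ᵘ⇒Admits integral   ∞          fr p = tt
  ∈ᵘ⇒Admits fractional ∞          fr p = tt

  Admits⇒∈ᵘ : ∀ φ U → FractionIn φ f → AdmitsUpper φ m U → x ∈ᵘ U
  Admits⇒∈ᵘ integral   (closed b) fr m≤b = proj₂ (⊑ι⇔ b x) (⊑-trans (ι-above fr) (ι-mono-⊑ m≤b))
  Admits⇒∈ᵘ fractional (closed b) fr m<b = proj₂ (⊑ι⇔ b x) (⊏⇒⊑ (below-upper {fractional} fr m<b))
  Admits⇒∈ᵘ integral   (strict b) fr m<b = proj₂ (⊏ι⇔ b x) (below-upper {integral} fr m<b)
  Admits⇒∈ᵘ fractional (strict b) fr m<b = proj₂ (⊏ι⇔ b x) (below-upper {fractional} fr m<b)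
  Admits⇒∈ᵘ integral   ∞          fr _   = tt
  Admits⇒∈ᵘ fractional ∞          fr _   = tt

-- The constants of an interval are below K.
LowerBelow : ℕ → LowerBound → Set
LowerBelow K (closed a) = a ℕ.< K
LowerBelow K (strict a) = a ℕ.< K

UpperBelow : ℕ → UpperBound → Set
UpperBelow K (closed b) = b ℕ.< K
UpperBelow K (strict b) = b ℕ.< K
UpperBelow K ∞          = ⊤

Below : ℕ → Interval → Set
Below K I = LowerBelow K (Interval.lower I) × UpperBelow K (Interval.upper I)

-- Capping at K does not affect membership in such intervals.
module _ {K m : ℕ} where

  private
    ≤-cap : ∀ {a} → a ℕ.< K → a ℕ.≤ m → a ℕ.≤ m ℕ.⊓ K
    ≤-cap a<K a≤m = ℕ.⊓-glb a≤m (ℕ.<⇒≤ a<K)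

    <-cap : ∀ {a} → a ℕ.< K → a ℕ.< m → a ℕ.< m ℕ.⊓ K
    <-cap a<K a<m = ℕ.⊓-glb a<m a<K

    cap-≤ : ∀ {a} → a ℕ.≤ m ℕ.⊓ K → a ℕ.≤ m
    cap-≤ p = ℕ.≤-trans p (ℕ.m⊓n≤m m K)

    ≤-uncap : ∀ {b} → b ℕ.< K → m ℕ.⊓ K ℕ.≤ b → m ℕ.≤ b
    ≤-uncap b<K p = ℕ.≮⇒≥ λ b<m → ℕ.<⇒≱ (<-cap b<K b<m) p

    <-uncap : ∀ {b} → b ℕ.< K → m ℕ.⊓ K ℕ.< b → m ℕ.< b
    <-uncap b<K p = ℕ.≰⇒> λ b≤m → ℕ.<⇒≱ p (≤-cap b<K b≤m)

    ≤-cap′ : ∀ {b} → m ℕ.≤ b → m ℕ.⊓ K ℕ.≤ b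
    ≤-cap′ p = ℕ.≤-trans (ℕ.m⊓n≤m m K) p

    <-cap′ : ∀ {b} → m ℕ.< b → m ℕ.⊓ K ℕ.< b
    <-cap′ p = ℕ.≤-<-trans (ℕ.m⊓n≤m m K) p

  admits-cap : ∀ φ I → Below K I → Admits φ m I → Admits φ (m ℕ.⊓ K) I
  admits-cap φ I (bl , bu) (l , u) = lower φ (Interval.lower I) bl l , upper φ (Interval.upper I) bu u
    where
    lower : ∀ φ L → LowerBelow K L → AdmitsLower φ m L → AdmitsLower φ (m ℕ.⊓ K) L
    lower φ          (closed a) = ≤-cap
    lower integral   (strict a) = <-cap
    lower fractional (strict a) = ≤-cap
    upper : ∀ φ U → UpperBelow K U → AdmitsUpper φ m U → AdmitsUpper φ (m ℕ.⊓ K) U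
    upper integral   (closed b) _ = ≤-cap′
    upper fractional (closed b) _ = <-cap′
    upper integral   (strict b) _ = <-cap′
    upper fractional (strict b) _ = <-cap′
    upper integral   ∞          _ _ = tt
    upper fractional ∞          _ _ = tt

  admits-uncap : ∀ φ I → Below K I → Admits φ (m ℕ.⊓ K) I → Admits φ m I
  admits-uncap φ I (bl , bu) (l , u) = lower φ (Interval.lower I) bl l , upper φ (Interval.upper I) bu u
    where
    lower : ∀ φ L → LowerBelow K L → AdmitsLower φ (m ℕ.⊓ K) L → AdmitsLower φ m L
    lower φ          (closed a) _ = cap-≤
    lower integral   (strict a) _ = cap-≤
    lower fractional (strict a) _ = cap-≤
    upper : ∀ φ U → UpperBelow K U → AdmitsUpper φ (m ℕ.⊓ K) U → AdmitsUpper φ m U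
    upper integral   (closed b) = ≤-uncap
    upper fractional (closed b) = <-uncap
    upper integral   (strict b) = <-uncap
    upper fractional (strict b) = <-uncap
    upper integral   ∞          _ _ = tt
    upper fractional ∞          _ _ = tt

------------------------------------------------------------------------
-- Markings realising a state

module Realisation (N : TPN) (K : ℕ) where
  open TPN N
  open Regions N K
  open Permutation (Token-setoid N) using (_↭_; ↭-refl; ↭-reflexive; ↭-sym; ↭-trans; ↭-prep; module PermutationReasoning)
  private module ↭ = PermutationProperties (Token-setoid N)
  open Setoid (Token-setoid N) using () renaming (_≈_ to _≈ᵗ_)

  -- The token has the place of the letter, and its age is the fractional
  -- part f added to an integer part which the letter caps.
  record Inst (f : ℝ) (l : Letter) (t : Token N) : Set where
    constructor inst
    field
      place   : proj₁ l ≡ proj₁ t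
      integer : ℕ
      age     : value (proj₂ t) ≈ ι integer ∔ f
      capped  : cap integer ≡ proj₂ l

  -- The marking realises the buckets, whose fractional parts increase
  -- strictly between lo and hi.
  data Chain (lo hi : ℝ) : List Bucket → Marking N → Set where
    end  : ∀ {M} → lo ⊏ hi → M ↭ [] → Chain lo hi [] M
    cons : ∀ {f b L ws R M} → lo ⊏ f → Pointwise (Inst f) b L → Chain f hi ws R → M ↭ L ++ R → Chain lo hi (b ∷ ws) M

  -- The marking realises the state, with fractional parts below hi.
  record RealBelow (hi : ℝ) (s : State) (M : Marking N) : Set where
    constructor real
    field
      {ints rest} : Marking N
      integers    : Pointwise (Inst 0#) (proj₁ s) ints
      chain       : Chain 0# hi (proj₂ s) rest
      parts       : M ↭ ints ++ rest

  Real : State → Marking N → Set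
  Real = RealBelow 1ℝ

  inst-≈ : ∀ {f g l t} → f ≈ g → Inst f l t → Inst g l t
  inst-≈ f≈g (inst eq m x≈ c) = inst eq m (≈-trans x≈ (∔-congˡ (ι m) f≈g)) c

  inst-≈ᵗ : ∀ {f l t u} → t ≈ᵗ u → Inst f l t → Inst f l u
  inst-≈ᵗ {t = _ , x} {_ , y} (refl , x≃y) (inst eq m x≈ c) = inst eq m (≈-trans (≈-sym (≃⇒≈ (value x) (value y) x≃y)) x≈) c

  bucket-≈ : ∀ {f g b L} → f ≈ g → Pointwise (Inst f) b L → Pointwise (Inst g) b L
  bucket-≈ f≈g = Pointwise.map (inst-≈ f≈g)

  chain-resp : ∀ {lo hi ws M M′} → M′ ↭ M → Chain lo hi ws M → Chain lo hi ws M′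
  chain-resp p (end lt q)         = end lt (↭-trans p q)
  chain-resp p (cons lt bs ch q)  = cons lt bs ch (↭-trans p q)

  real-resp : ∀ {hi s M M′} → M′ ↭ M → RealBelow hi s M → RealBelow hi s M′
  real-resp p (real Z C q) = real Z C (↭-trans p q)

  chain-weaken : ∀ {lo hi lo′ hi′ ws M} → lo′ ⊑ lo → hi ⊑ hi′ → Chain lo hi ws M → Chain lo′ hi′ ws M
  chain-weaken l h (end lt q)        = end (⊏-⊑-trans (⊑-⊏-trans l lt) h) q
  chain-weaken l h (cons lt bs ch q) = cons (⊑-⊏-trans l lt) bs (chain-weaken ⊑-refl h ch) q

  chain-< : ∀ {lo hi ws M} → Chain lo hi ws M → lo ⊏ hi
  chain-< (end lt _)        = lt
  chain-< (cons lt _ ch _)  = ⊏-trans lt (chain-< ch)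

  chain-++ : ∀ {lo g hi us l vs U L V} → Chain lo g us U → Pointwise (Inst g) l L → Chain g hi vs V →
    Chain lo hi (us ++ l ∷ vs) (U ++ L ++ V)
  chain-++ {L = L} {V} (end lt p) bs ch = cons lt bs ch (↭.++⁺ʳ (L ++ V) p)
  chain-++ {U = U} {L} {V} (cons {L = L′} {R = R} lt bs′ ch′ p) bs ch = cons lt bs′ (chain-++ ch′ bs ch)
    (↭-trans (↭.++⁺ʳ (L ++ V) p) (↭.++-assoc L′ R (L ++ V)))

  -- A chain cut at one of its buckets, of fractional part g.
  record Cut (lo hi : ℝ) (us : List Bucket) (l : Bucket) (vs : List Bucket) (M : Marking N) : Set where
    constructor cut
    field
      {g}     : ℝ
      {U L V} : Marking N
      below   : Chain lo g us U
      at      : Pointwise (Inst g) l L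
      above   : Chain g hi vs V
      whole   : M ↭ U ++ L ++ V

  chain-cut : ∀ {lo hi} us {l vs M} → Chain lo hi (us ++ l ∷ vs) M → Cut lo hi us l vs M
  chain-cut []       (cons lt bs ch p) = cut (end lt ↭-refl) bs ch p
  chain-cut (u ∷ us) (cons {L = L′} lt bs ch p) with chain-cut us ch
  ... | cut {U = U} {L} {V} c₁ b c₂ q = cut (cons lt bs c₁ ↭-refl) b c₂
    (↭-trans p (↭-trans (↭.++⁺ˡ L′ q) (↭-sym (↭.++-assoc L′ U (L ++ V)))))

  chain-clean : ∀ {lo hi ws M} → Chain lo hi ws M → Chain lo hi (filter nonEmpty? ws) M
  chain-clean (end lt p)                   = end lt p
  chain-clean {ws = [] ∷ ws}      (cons lt [] ch p) = chain-weaken (⊏⇒⊑ lt) ⊑-refl (chain-clean (chain-resp p ch))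
  chain-clean {ws = (x ∷ b) ∷ ws} (cons lt bs ch p) = cons lt bs (chain-clean ch) p

  real-clean : ∀ {hi s M} → RealBelow hi s M → RealBelow hi (clean s) M
  real-clean (real Z C p) = real Z (chain-clean C) p

  real-weaken : ∀ {hi hi′ s M} → hi ⊑ hi′ → RealBelow hi s M → RealBelow hi′ s M
  real-weaken h (real Z C p) = real Z (chain-weaken ⊑-refl h C) p

  chain-size : ∀ {lo hi ws M} → Chain lo hi ws M → length M ≡ total ws
  chain-size (end _ p)                      = ↭.xs↭ys⇒|xs|≡|ys| p
  chain-size (cons {L = L} {R = R} _ bs ch p) = trans (↭.xs↭ys⇒|xs|≡|ys| p)
    (trans (List.length-++ L) (cong₂ ℕ._+_ (sym (Pointwise.Pointwise-length bs)) (chain-size ch)))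

  real-size : ∀ {hi s M} → RealBelow hi s M → length M ≡ size s
  real-size (real {ints} Z C p) = trans (↭.xs↭ys⇒|xs|≡|ys| p)
    (trans (List.length-++ ints) (cong₂ ℕ._+_ (sym (Pointwise.Pointwise-length Z)) (chain-size C)))

  -- Elapse of time

  aged : ℝ≥0 → Token N → Token N
  aged d (p , x) = p , x ⊕ d

  aged-cong : ∀ d {t u} → t ≈ᵗ u → aged d t ≈ᵗ aged d u
  aged-cong d {_ , x} {_ , y} (eq , x≃y) = eq , ≈⇒≃ (value (x ⊕ d)) (value (y ⊕ d))
    (≈-trans (value-⊕ x d) (≈-trans (∔-congʳ (value d) (≃⇒≈ (value x) (value y) x≃y)) (≈-sym (value-⊕ y d))))

  ageBy-↭ : ∀ d {M M′} → M ↭ M′ → ageBy N d M ↭ ageBy N d M′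
  ageBy-↭ d = ↭.map⁺ (Token-setoid N) (λ {t} {u} → aged-cong d {t} {u})

  ageBy-++ : ∀ d M M′ → ageBy N d (M ++ M′) ≡ ageBy N d M ++ ageBy N d M′
  ageBy-++ d = List.map-++ (aged d)

  ageBy-split : ∀ d {M} L R → M ↭ L ++ R → ageBy N d M ↭ ageBy N d L ++ ageBy N d R
  ageBy-split d L R p = ↭-trans (ageBy-↭ d p) (↭-reflexive (ageBy-++ d L R))

  -- Two delays in succession amount to one.
  ageBy-∔ : ∀ d₁ d₂ d → value d₁ ∔ value d₂ ≈ value d → ∀ M → ageBy N d M ↭ ageBy N d₂ (ageBy N d₁ M)
  ageBy-∔ d₁ d₂ d eq []            = ↭-refl
  ageBy-∔ d₁ d₂ d eq ((p , x) ∷ M) = Permutation.prep (refl , ≈⇒≃ (value (x ⊕ d)) (value ((x ⊕ d₁) ⊕ d₂)) (begin-equality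
    value (x ⊕ d)                     ≈⟨ value-⊕ x d ⟩
    value x ∔ value d                 ≈⟨ ∔-congˡ (value x) eq ⟨
    value x ∔ (value d₁ ∔ value d₂)   ≈⟨ ∔-assoc (value x) (value d₁) (value d₂) ⟨
    (value x ∔ value d₁) ∔ value d₂   ≈⟨ ∔-congʳ (value d₂) (value-⊕ x d₁) ⟨
    value (x ⊕ d₁) ∔ value d₂         ≈⟨ value-⊕ (x ⊕ d₁) d₂ ⟨
    value ((x ⊕ d₁) ⊕ d₂)             ∎)) (ageBy-∔ d₁ d₂ d eq M)
    where open ℝ-Reasoning

  ageBy-zero : ∀ d → value d ≈ 0# → ∀ M → ageBy N d M ↭ M
  ageBy-zero d eq []            = ↭-refl
  ageBy-zero d eq ((p , x) ∷ M) = Permutation.prep (refl , ≈⇒≃ (value (x ⊕ d)) (value x)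
    (≈-trans (value-⊕ x d) (≈-trans (∔-congˡ (value x) eq) (∔-identityʳ (value x))))) (ageBy-zero d eq M)

  -- Delaying by d shifts fractional parts by e and acts on letters by h.
  Shift : ℝ≥0 → ℝ → (Letter → Letter) → Set
  Shift d e h = ∀ {f l t} → Inst f l t → Inst (f ∔ e) (h l) (aged d t)

  shift-id : ∀ d {e} → value d ≈ e → Shift d e id
  shift-id d {e} d≈e {f} {t = p , x} (inst eq m x≈ c) = inst eq m (begin-equality
    value (x ⊕ d)       ≈⟨ value-⊕ x d ⟩
    value x ∔ value d   ≈⟨ ∔-cong x≈ d≈e ⟩
    (ι m ∔ f) ∔ e       ≈⟨ ∔-assoc (ι m) f e ⟩
    ι m ∔ (f ∔ e)       ∎) c
    where open ℝ-Reasoning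

  shift-older : ∀ d {e} → value d ≈ 1ℝ ∔ e → Shift d e older
  shift-older d {e} d≈ {f} {t = p , x} (inst eq m x≈ refl) = inst eq (suc m) (begin-equality
    value (x ⊕ d)           ≈⟨ value-⊕ x d ⟩
    value x ∔ value d       ≈⟨ ∔-cong x≈ d≈ ⟩
    (ι m ∔ f) ∔ (1ℝ ∔ e)    ≈⟨ solve⊞ 4 (λ m f o e → (m ⊞ f) ⊞ (o ⊞ e) ⊜ (m ⊞ o) ⊞ (f ⊞ e)) ≈-refl (ι m) f 1ℝ e ⟩
    (ι m ∔ 1ℝ) ∔ (f ∔ e)    ≈⟨ ∔-congʳ (f ∔ e) (ι-suc m) ⟨
    ι (suc m) ∔ (f ∔ e)     ∎) (cap-suc)
    where
    open ℝ-Reasoning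
    ⊓-suc : ∀ m → suc m ℕ.⊓ K ≡ suc (m ℕ.⊓ K) ℕ.⊓ K
    ⊓-suc m with ℕ.≤-total m K
    ... | inj₁ m≤K = cong (λ n → suc n ℕ.⊓ K) (sym (ℕ.m≤n⇒m⊓n≡m m≤K))
    ... | inj₂ K≤m = trans (ℕ.m≥n⇒m⊓n≡n (ℕ.m≤n⇒m≤1+n K≤m))
      (sym (trans (cong (λ n → suc n ℕ.⊓ K) (ℕ.m≥n⇒m⊓n≡n K≤m)) (ℕ.m≥n⇒m⊓n≡n (ℕ.n≤1+n K))))
    cap-suc : cap (suc m) ≡ cap (suc (toℕ (cap m)))
    cap-suc = Fin.toℕ-injective (trans (toℕ-cap (suc m)) (trans (⊓-suc m)
      (trans (cong (λ n → suc n ℕ.⊓ K) (sym (toℕ-cap m))) (sym (toℕ-cap (suc (toℕ (cap m))))))))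

  module _ (d : ℝ≥0) {e : ℝ} {h : Letter → Letter} (sh : Shift d e h) where

    bucket-shift : ∀ {f b L} → Pointwise (Inst f) b L → Pointwise (Inst (f ∔ e)) (map h b) (ageBy N d L)
    bucket-shift []       = []
    bucket-shift (i ∷ is) = sh i ∷ bucket-shift is

    chain-shift : ∀ {lo hi ws M} → Chain lo hi ws M → Chain (lo ∔ e) (hi ∔ e) (map (map h) ws) (ageBy N d M)
    chain-shift (end lt p) = end (∔-monoˡ-⊏ e lt) (ageBy-↭ d p)
    chain-shift (cons {L = L} {R = R} lt bs ch p) =
      cons (∔-monoˡ-⊏ e lt) (bucket-shift bs) (chain-shift ch) (ageBy-split d L R p)

  module _ (d : ℝ≥0) where

    bucket-drift : ∀ {f b L} → Pointwise (Inst f) b L → Pointwise (Inst (f ∔ value d)) b (ageBy N d L)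
    bucket-drift {f} {b} {L} bs = subst (λ b → Pointwise (Inst (f ∔ value d)) b (ageBy N d L)) (List.map-id b)
      (bucket-shift d (shift-id d ≈-refl) bs)

    chain-drift : ∀ {lo hi ws M} → Chain lo hi ws M → Chain (lo ∔ value d) (hi ∔ value d) ws (ageBy N d M)
    chain-drift {lo} {hi} {ws} {M} ch = subst (λ ws → Chain (lo ∔ value d) (hi ∔ value d) ws (ageBy N d M))
      (trans (List.map-cong List.map-id ws) (List.map-id ws)) (chain-shift d (shift-id d ≈-refl) ch)

  -- The effect on states of a delay of one unit, of a delay in which no bucket
  -- reaches an integer, and of one at whose end the bucket at g does.
  elapse-unit : ∀ d {s M} → value d ≈ 1ℝ → Real s M → Real (map older (proj₁ s) , map (map older) (proj₂ s)) (ageBy N d M)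
  elapse-unit d eq (real {ints} {rest} Z C p) = real
    (bucket-≈ (∔-identityʳ 0#) (bucket-shift d sh Z))
    (chain-weaken (≈⇒⊒ (∔-identityʳ 0#)) (≈⇒⊑ (∔-identityʳ 1ℝ)) (chain-shift d sh C))
    (ageBy-split d ints rest p)
    where
    sh : Shift d 0# older
    sh = shift-older d (≈-trans eq (≈-sym (∔-identityʳ 1ℝ)))

  elapse-drift : ∀ d {hi s M} → 0# ⊏ value d → hi ∔ value d ⊑ 1ℝ → RealBelow hi s M → Real ([] , proj₁ s ∷ proj₂ s) (ageBy N d M)
  elapse-drift d 0<d le (real {ints} {rest} Z C p) = real []
    (cons (⊏-⊑-trans 0<d (⊑-trans (≈⇒⊒ (∔-identityʳ (value d))) (≈⇒⊑ (∔-comm (value d) 0#))))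
      (bucket-drift d Z)
      (chain-weaken ⊑-refl le (chain-drift d C)) ↭-refl)
    (ageBy-split d ints rest p)

  elapse-wrap : ∀ d {h g z us l vs Z U L V M} → g ∔ value d ≈ 1ℝ → h ⊑ g →
    Pointwise (Inst 0#) z Z → Chain 0# h us U → Pointwise (Inst g) l L → Chain g 1ℝ vs V → M ↭ Z ++ U ++ L ++ V →
    RealBelow (h ∔ value d) (map older l , map (map older) vs ++ z ∷ us) (ageBy N d M)
  elapse-wrap d {h} {g} {Z = Z} {U} {L} {V} {M} g+d h⊑g zs below at above p = real
    (bucket-≈ (∔-inverseʳ g) (bucket-shift d sh at))
    (chain-++
      (chain-weaken (≈⇒⊒ (∔-inverseʳ g)) (≈⇒⊑ (≈-trans (≈-sym d≈) (≈-trans (≈-sym (∔-identityʳ (value d))) (∔-comm (value d) 0#)))) (chain-shift d sh above))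
      (bucket-drift d zs)
      (chain-drift d below))
    (begin
      ageBy N d M
        ↭⟨ ageBy-↭ d p ⟩
      ageBy N d (Z ++ U ++ L ++ V)
        ≡⟨ trans (ageBy-++ d Z _) (cong (aZ ++_) (trans (ageBy-++ d U _) (cong (aU ++_) (ageBy-++ d L V)))) ⟩
      aZ ++ aU ++ aL ++ aV
        ↭⟨ shuffle aZ aU aL aV ⟩
      aL ++ aV ++ aZ ++ aU ∎)
    where
    open PermutationReasoning
    aZ = ageBy N d Z
    aU = ageBy N d U
    aL = ageBy N d L
    aV = ageBy N d V
    d≈ : value d ≈ 1ℝ ∔ ⊖ g
    d≈ = ∔-cancelʳ g (≈-trans (∔-comm (value d) g) (≈-trans g+d (≈-sym
      (≈-trans (∔-assoc 1ℝ (⊖ g) g) (≈-trans (∔-congˡ 1ℝ (≈-trans (∔-comm (⊖ g) g) (∔-inverseʳ g))) (∔-identityʳ 1ℝ))))))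
    sh : Shift d (⊖ g) older
    sh = shift-older d d≈
    shuffle : ∀ A B C D → A ++ B ++ C ++ D ↭ C ++ D ++ A ++ B
    shuffle A B C D = ↭-trans (↭-reflexive (sym (List.++-assoc A B (C ++ D))))
      (↭-trans (↭.++-comm (A ++ B) (C ++ D)) (↭-reflexive (List.++-assoc C D (A ++ B))))

------------------------------------------------------------------------
-- Firing transitions on states and on markings

module Simulation (N : TPN) (K : ℕ)
  (inBelow  : ∀ τ → All (Below K ∘ proj₂) (arcs N (TPN.In N τ)))
  (outBelow : ∀ τ → All (Below K ∘ proj₂) (arcs N (TPN.Out N τ)))
  where
  open TPN N
  open Regions N K
  open Realisation N K
  open Permutation (Token-setoid N) using (_↭_; ↭-refl; ↭-reflexive; ↭-sym; ↭-trans; ↭-prep; ↭-swap; prep; module PermutationReasoning)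
  private module ↭ = PermutationProperties (Token-setoid N)
  open Setoid (Token-setoid N) using () renaming (_≈_ to _≈ᵗ_; refl to ≈ᵗ-refl; sym to ≈ᵗ-sym)

  -- The token may be moved along the arc.
  Match : Arc → Token N → Set
  Match (p , I) (q , x) = p ≡ q × x ∈ᴵ I

  match⇒fits : ∀ {φ f l t} a → Below K (proj₂ a) → FractionIn φ f → Inst f l t → Match a t → Fits φ a l
  match⇒fits {φ} {l = l} (p , I) bel fr (inst eq m x≈ c) (eq′ , (lo , up)) = trans eq′ (sym eq) ,
    subst (λ n → Admits φ n I) (trans (sym (toℕ-cap m)) (cong toℕ c))
      (admits-cap φ I bel (∈ˡ⇒Admits x≈ φ (Interval.lower I) fr lo , ∈ᵘ⇒Admits x≈ φ (Interval.upper I) fr up))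

  fits⇒match : ∀ {φ f l t} a → Below K (proj₂ a) → FractionIn φ f → Inst f l t → Fits φ a l → Match a t
  fits⇒match {φ} {l = l} (p , I) bel fr (inst eq m x≈ c) (eq′ , adm) = trans eq′ eq ,
    (Admits⇒∈ˡ x≈ φ (Interval.lower I) fr (proj₁ adm′) , Admits⇒∈ᵘ x≈ φ (Interval.upper I) fr (proj₂ adm′))
    where
    adm′ : Admits φ m I
    adm′ = admits-uncap φ I bel (subst (λ n → Admits φ n I) (trans (cong toℕ (sym c)) (toℕ-cap m)) adm)

  module _ (a : Arc) (bel : Below K (proj₂ a)) where

    -- Removal of a token

    bucket-remove : ∀ {φ f b L} t → FractionIn φ f → Match a t → Pointwise (Inst f) b L → Any (t ≈ᵗ_) L →
      ∃[ c ] ∃[ R ] Delete φ a b c × L ↭ t ∷ R × Pointwise (Inst f) c R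
    bucket-remove t fr mt (_∷_ {y = u} i is) (here t≈u) = _ , _ ,
      here (match⇒fits a bel fr (inst-≈ᵗ {t = u} {t} (≈ᵗ-sym {t} {u} t≈u) i) mt) , prep (≈ᵗ-sym {t} {u} t≈u) ↭-refl , is
    bucket-remove t fr mt (_∷_ {y = u} i is) (there m) =
      let _ , R , d , p , js = bucket-remove t fr mt is m in
      _ , u ∷ R , there d , ↭-trans (↭-prep u p) (↭-swap u t ↭-refl) , i ∷ js

    ∈-resp : ∀ t {M M′} → M ↭ M′ → Any (t ≈ᵗ_) M → Any (t ≈ᵗ_) M′
    ∈-resp t = ↭.∈-resp-↭ {x = t}

    chain-remove : ∀ {lo hi ws M} t → 0# ⊑ lo → hi ⊑ 1ℝ → Match a t → Chain lo hi ws M → Any (t ≈ᵗ_) M →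
      ∃[ vs ] ∃[ R ] Take⁺ a ws vs × M ↭ t ∷ R × Chain lo hi vs R
    chain-remove t l h mt (end _ p) m = case (∈-resp t p m)
      where
      case : ∀ {A : Set} → Any (t ≈ᵗ_) [] → A
      case ()
    chain-remove t l h mt (cons {b = b} {L} {ws} {R} {M} lt bs ch p) m =
      [ front , rear ]′ (Any.++⁻ L (∈-resp t p m))
      where
      Removed : Set
      Removed = ∃[ vs ] ∃[ S ] Take⁺ a (b ∷ ws) vs × M ↭ t ∷ S × Chain _ _ vs S
      front : Any (t ≈ᵗ_) L → Removed
      front m =
        let c , S , d , q , cs = bucket-remove t (⊑-⊏-trans l lt , ⊏-⊑-trans (chain-< ch) h) mt bs m in
        _ , S ++ R , here d , ↭-trans p (↭.++⁺ʳ R q) , cons lt cs ch ↭-refl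
      rear : Any (t ≈ᵗ_) R → Removed
      rear m =
        let vs , S , d , q , ch′ = chain-remove t (⊏⇒⊑ (⊑-⊏-trans l lt)) h mt ch m in
        _ , L ++ S , there d , ↭-trans p (↭-trans (↭.++⁺ˡ L q) (↭.↭-shift L S)) , cons lt bs ch′ ↭-refl

    take-complete : ∀ {s M R} t → Match a t → Real s M → M ↭ t ∷ R → ∃[ s′ ] Take a s s′ × Real s′ R
    take-complete {s} {M} {R} t mt (real {ints} {rest} Z C p) q =
      [ front , rear ]′ (Any.++⁻ ints (∈-resp t (↭-trans (↭-sym q) p) (here (≈ᵗ-refl {t}))))
      where
      Taken : Set
      Taken = ∃[ s′ ] Take a s s′ × Real s′ R
      front : Any (t ≈ᵗ_) ints → Taken
      front m = let c , S , d , r , cs = bucket-remove t ≈-refl mt Z m in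
        _ , integral d , real cs C (↭.drop-∷ (↭-trans (↭-sym q) (↭-trans p (↭.++⁺ʳ rest r))))
      rear : Any (t ≈ᵗ_) rest → Taken
      rear m = let vs , S , d , r , C′ = chain-remove t ⊑-refl ⊑-refl mt C m in
        _ , fractional d , real Z C′ (↭.drop-∷ (↭-trans (↭-sym q) (↭-trans p (↭-trans (↭.++⁺ˡ ints r) (↭.↭-shift ints S)))))

    bucket-delete : ∀ {φ f b c L} → FractionIn φ f → Delete φ a b c → Pointwise (Inst f) b L →
      ∃[ t ] ∃[ R ] Match a t × L ↭ t ∷ R × Pointwise (Inst f) c R
    bucket-delete fr (here f)  (i ∷ is) = _ , _ , fits⇒match a bel fr i f , ↭-refl , is
    bucket-delete fr (there d) (_∷_ {y = u} i is) =
      let t , R , mt , p , js = bucket-delete fr d is in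
      t , u ∷ R , mt , ↭-trans (↭-prep u p) (↭-swap u t ↭-refl) , i ∷ js

    chain-take : ∀ {lo hi ws vs M} → 0# ⊑ lo → hi ⊑ 1ℝ → Take⁺ a ws vs → Chain lo hi ws M →
      ∃[ t ] ∃[ R ] Match a t × M ↭ t ∷ R × Chain lo hi vs R
    chain-take l h (here d) (cons {R = R} lt bs ch p) =
      let t , S , mt , q , cs = bucket-delete (⊑-⊏-trans l lt , ⊏-⊑-trans (chain-< ch) h) d bs in
      t , S ++ R , mt , ↭-trans p (↭.++⁺ʳ R q) , cons lt cs ch ↭-refl
    chain-take l h (there d) (cons {L = L} lt bs ch p) =
      let t , S , mt , q , ch′ = chain-take (⊏⇒⊑ (⊑-⊏-trans l lt)) h d ch in
      t , L ++ S , mt , ↭-trans p (↭-trans (↭.++⁺ˡ L q) (↭.↭-shift L S)) , cons lt bs ch′ ↭-refl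

    take-sound : ∀ {s s′ M} → Real s M → Take a s s′ → ∃[ t ] ∃[ R ] Match a t × M ↭ t ∷ R × Real s′ R
    take-sound (real {ints} {rest} Z C p) (integral d) =
      let t , S , mt , q , cs = bucket-delete ≈-refl d Z in
      t , S ++ rest , mt , ↭-trans p (↭.++⁺ʳ rest q) , real cs C ↭-refl
    take-sound (real {ints} {rest} Z C p) (fractional d) =
      let t , S , mt , q , C′ = chain-take ⊑-refl ⊑-refl d C in
      t , ints ++ S , mt , ↭-trans p (↭-trans (↭.++⁺ˡ ints q) (↭.↭-shift ints S)) , real Z C′ ↭-refl

    -- Creation of a token for a given letter

    fresh : ∀ {f} → 0# ⊑ f → ∀ l → ∃[ t ] Inst f l t
    fresh {f} 0⊑f (p , n) = (p , (x , toℝ≥0 x 0⊑x)) , inst refl (toℕ n) ≈-refl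
      (Fin.toℕ-injective (trans (toℕ-cap (toℕ n)) (ℕ.m≤n⇒m⊓n≡m (ℕ.s≤s⁻¹ (Fin.toℕ<n n)))))
      where
      x = ι (toℕ n) ∔ f
      0⊑x : 0# ⊑ x
      0⊑x = ⊑-trans (≈⇒⊒ (∔-identityʳ 0#)) (∔-mono-⊑ (⊑-trans (≈⇒⊒ (≈-reflexive ι-zero)) (ι-mono-⊑ z≤n)) 0⊑f)

    chain-raise : ∀ {lo hi ws M} → Chain lo hi ws M → ∃[ g ] lo ⊏ g × Chain g hi ws M
    chain-raise (end lt p)        = let g , l , h = ⊏-dense lt in g , l , end h p
    chain-raise (cons lt bs ch p) = let g , l , h = ⊏-dense lt in g , l , cons h bs ch p

    chain-put : ∀ {lo hi ws vs M} → 0# ⊑ lo → hi ⊑ 1ℝ → Put⁺ a ws vs → Chain lo hi ws M →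
      ∃[ t ] Match a t × Chain lo hi vs (t ∷ M)
    chain-put l h (new {x} f) ch with chain-raise ch
    ... | g , lt , ch′ = let 0⊏g = ⊑-⊏-trans l lt; t , i = fresh (⊏⇒⊑ 0⊏g) x in
      t , fits⇒match a bel (0⊏g , ⊏-⊑-trans (chain-< ch′) h) i f , cons lt (i ∷ []) ch′ ↭-refl
    chain-put l h (here {x} f) (cons lt bs ch p) = let 0⊏g = ⊑-⊏-trans l lt; t , i = fresh (⊏⇒⊑ 0⊏g) x in
      t , fits⇒match a bel (0⊏g , ⊏-⊑-trans (chain-< ch) h) i f , cons lt (i ∷ bs) ch (↭-prep t p)
    chain-put l h (there d) (cons {L = L} {R = R} lt bs ch p) =
      let t , mt , ch′ = chain-put (⊏⇒⊑ (⊑-⊏-trans l lt)) h d ch in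
      t , mt , cons lt bs ch′ (↭-trans (↭-prep t p) (↭-sym (↭.↭-shift L R)))

    put-sound : ∀ {s s′ M} → Real s M → Put a s s′ → ∃[ t ] Match a t × Real s′ (t ∷ M)
    put-sound (real Z C p) (integral {x} f) = let t , i = fresh ⊑-refl x in
      t , fits⇒match a bel ≈-refl i f , real (i ∷ Z) C (↭-prep t p)
    put-sound (real {ints} {rest} Z C p) (fractional d) =
      let t , mt , C′ = chain-put ⊑-refl ⊑-refl d C in
      t , mt , real Z C′ (↭-trans (↭-prep t p) (↭-sym (↭.↭-shift ints rest)))

  takes-sound : ∀ {as s s′ M} → All (Below K ∘ proj₂) as → Real s M → Sequence Take as s s′ →
    ∃[ b ] ∃[ R ] Pointwise Match as b × M ↭ b ++ R × Real s′ R
  takes-sound []           r []       = _ , _ , [] , ↭-refl , r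
  takes-sound (bel ∷ bels) r (x ∷ xs) =
    let t , _ , mt , p , r′ = take-sound _ bel r x
        b , R , ms , q , r″ = takes-sound bels r′ xs
    in t ∷ b , R , mt ∷ ms , ↭-trans p (↭-prep t q) , r″

  takes-complete : ∀ {as s b M R} → All (Below K ∘ proj₂) as → Real s M → Pointwise Match as b → M ↭ b ++ R →
    ∃[ s′ ] Sequence Take as s s′ × Real s′ R
  takes-complete {b = []} []           r []        p = _ , [] , real-resp (↭-sym p) r
  takes-complete {b = t ∷ _} (bel ∷ bels) r (mt ∷ ms) p =
    let _ , x , r′ = take-complete _ bel t mt r p
        s′ , xs , r″ = takes-complete bels r′ ms ↭-refl
    in s′ , x ∷ xs , r″

  puts-sound : ∀ {as s s′ R} → All (Below K ∘ proj₂) as → Real s R → Sequence Put as s s′ →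
    ∃[ b ] Pointwise Match as b × Real s′ (R ++ b)
  puts-sound {R = R} []           r []       = [] , [] , real-resp (↭-reflexive (List.++-identityʳ R)) r
  puts-sound {R = R} (bel ∷ bels) r (x ∷ xs) =
    let t , mt , r′ = put-sound _ bel r x
        b , ms , r″ = puts-sound bels r′ xs
    in t ∷ b , mt ∷ ms , real-resp (↭.↭-shift R b) r″

  ----------------------------------------------------------------------
  -- Every step of states is realised by steps of markings

  -- The fractional parts leave room for a small positive delay below hi.
  chain-room : ∀ {lo hi ws M} → Chain lo hi ws M → ∃[ d ] ∃[ h ] 0# ⊏ d × h ∔ d ≈ hi × Chain lo h ws M
  chain-room {lo} {hi} (end lt p) =
    let d , 0⊏d , r = ⊏-room lt; h , eq = hi ∸ d in
    d , h , 0⊏d , eq , end (∔-cancelʳ-⊏ d (⊏-⊑-trans r (≈⇒⊒ eq))) p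
  chain-room (cons lt bs ch p) =
    let d , h , 0⊏d , eq , ch′ = chain-room ch in d , h , 0⊏d , eq , cons lt bs ch′ p

  -- A positive solution of g ∔ d ≈ 1, as a delay.
  delay-to-1 : ∀ {g} → g ⊏ 1ℝ → ∃[ d ] 0# ⊏ value d × g ∔ value d ≈ 1ℝ
  delay-to-1 {g} g⊏1 with 1ℝ ∸ g
  ... | d , eq = (d , toℝ≥0 d (⊏⇒⊑ 0⊏d)) , 0⊏d , ≈-trans (∔-comm g d) eq
    where
    0⊏d : 0# ⊏ d
    0⊏d = ∔-cancelʳ-⊏ g (⊑-⊏-trans (≈⇒⊑ (≈-trans (∔-comm 0# g) (∔-identityʳ g))) (⊏-⊑-trans g⊏1 (≈⇒⊒ eq)))

  elapse : ∀ d → 0# ⊏ value d → ∀ M → Step N M (ageBy N d M)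
  elapse d 0⊏d M = inj₁ (d , 0⊏⇒0< (value d) 0⊏d , ↭-refl)

  unit-delay : ℝ≥0
  unit-delay = 1ℝ , toℝ≥0 1ℝ (⊏⇒⊑ 0⊏1)

  -- Some step from M leads to a marking realising s.
  Stepped : State → Marking N → Set
  Stepped s M = ∃[ M′ ] Step N M M′ × Real s M′

  elapsed : ∀ {s} d M → 0# ⊏ value d → Real s (ageBy N d M) → Stepped s M
  elapsed d M 0⊏d r = ageBy N d M , elapse d 0⊏d M , r

  fired : ∀ {s} τ {b₁ b₂ M R} → Pointwise Match (arcs N (In τ)) b₁ → Pointwise Match (arcs N (Out τ)) b₂ →
    M ↭ b₁ ++ R → Real s (R ++ b₂) → Stepped s M
  fired τ {b₁} {b₂} {M} {R} ms ms′ p r = R ++ b₂ , inj₂ (τ , b₁ , b₂ , R , ms , ms′ , p , ↭-refl) , r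

  wrap-sound : ∀ {z us l vs Z R M} → Pointwise (Inst 0#) z Z → Cut 0# 1ℝ us l vs R → M ↭ Z ++ R →
    Stepped (map older l , map (map older) vs ++ z ∷ us) M
  wrap-sound {Z = Z} {M = M} zs (cut below at above q) p =
    let d , 0⊏d , eq = delay-to-1 (chain-< above) in
    elapsed d M 0⊏d (real-weaken (≈⇒⊑ eq) (elapse-wrap d eq ⊑-refl zs below at above (↭-trans p (↭.++⁺ˡ Z q))))

  ⟶-sound : ∀ {s s′ M} → Real s M → s ⟶ s′ → Stepped s′ M
  ⟶-sound {M = M} r unit = elapsed unit-delay M 0⊏1 (elapse-unit unit-delay ≈-refl r)
  ⟶-sound {M = M} (real Z C p) drift =
    let e , h , 0⊏e , eq , C′ = chain-room C; d = e , toℝ≥0 e (⊏⇒⊑ 0⊏e) in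
    elapsed d M 0⊏e (elapse-drift d 0⊏e (≈⇒⊑ eq) (real Z C′ p))
  ⟶-sound (real Z C p) (wrap us) = wrap-sound Z (chain-cut us C) p
  ⟶-sound r (fire τ takes puts) =
    let b₁ , R , ms , p , r′ = takes-sound (inBelow τ) r takes
        b₂ , ms′ , r″ = puts-sound (outBelow τ) r′ puts
    in fired τ ms ms′ p r″

  ⇒⋆-sound : ∀ {s s′ M} → Real s M → Star _⇒_ s s′ → ∃[ M′ ] Reach N M M′ × Real s′ M′
  ⇒⋆-sound r ε = _ , ε , r
  ⇒⋆-sound r ((_ , st , refl) ◅ sts) =
    let _ , move , r′ = ⟶-sound r st
        M′ , steps , r″ = ⇒⋆-sound (real-clean r′) sts
    in M′ , move ◅ steps , r″

  ----------------------------------------------------------------------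
  -- Every step of markings realises steps of states

  -- The fractional parts of the buckets.
  fractions : ∀ {lo hi ws M} → Chain lo hi ws M → List ℝ
  fractions (end _ _)               = []
  fractions (cons {f} _ _ ch _) = f ∷ fractions ch

  -- The place of h among the fractional parts of a chain: above all of
  -- them, or at or before some bucket.
  data Located (lo h : ℝ) (M : Marking N) : List Bucket → Set where
    top    : ∀ {ws} → Chain lo h ws M → Located lo h M ws
    bottom : ∀ {g} us {l vs U L V} → h ⊑ g → h ≈ g ⊎ h ⊏ g →
      Chain lo h us U → Pointwise (Inst g) l L → Chain g 1ℝ vs V → M ↭ U ++ L ++ V → Located lo h M (us ++ l ∷ vs)

  chain-locate : ∀ {lo h ws M} (C : Chain lo 1ℝ ws M) → lo ⊏ h → All (Tri h) (fractions C) → Located lo h M ws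
  chain-locate (end _ p) lo⊏h [] = top (end lo⊏h p)
  chain-locate (cons lt bs ch p) lo⊏h (inj₁ h⊏g ∷ _) =
    bottom [] (⊏⇒⊑ h⊏g) (inj₂ h⊏g) (end lo⊏h ↭-refl) bs ch p
  chain-locate (cons lt bs ch p) lo⊏h (inj₂ (inj₁ h≈g) ∷ _) =
    bottom [] (≈⇒⊑ h≈g) (inj₁ h≈g) (end lo⊏h ↭-refl) bs ch p
  chain-locate (cons {L = L} lt bs ch p) lo⊏h (inj₂ (inj₂ g⊏h) ∷ tri) with chain-locate ch g⊏h tri
  ... | top ch′ = top (cons lt bs ch′ p)
  ... | bottom us {U = U} {L′} {V} le c below at above q = bottom (_ ∷ us) le c (cons lt bs below ↭-refl) at above
    (↭-trans p (↭-trans (↭.++⁺ˡ L q) (↭-sym (↭.++-assoc L U (L′ ++ V)))))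

  -- Insertion of a token; a property of fractional parts is kept track of.
  chain-insert : ∀ (P : ℝ → Set) {a f l t lo hi ws M} → Fits fractional a l → Inst f l t →
    lo ⊏ f → f ⊏ hi → (C : Chain lo hi ws M) → All (Tri f) (fractions C) → P f → All P (fractions C) →
    ∃[ vs ] Put⁺ a ws vs × Σ[ C′ ∈ Chain lo hi vs (t ∷ M) ] All P (fractions C′)
  chain-insert P {t = t} ft i l h (end lt p) [] pf [] =
    _ , new ft , cons l (i ∷ []) (end h p) ↭-refl , pf ∷ []
  chain-insert P ft i l h (cons lt bs ch p) (inj₁ f⊏g ∷ tri) pf (pg ∷ ps) =
    _ , new ft , cons l (i ∷ []) (cons f⊏g bs ch p) ↭-refl , pf ∷ pg ∷ ps
  chain-insert P {t = t} ft i l h (cons lt bs ch p) (inj₂ (inj₁ f≈g) ∷ tri) pf (pg ∷ ps) =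
    _ , here ft , cons lt (inst-≈ f≈g i ∷ bs) ch (↭-prep t p) , pg ∷ ps
  chain-insert P {t = t} ft i l h (cons {L = L} {R = R} lt bs ch p) (inj₂ (inj₂ g⊏f) ∷ tri) pf (pg ∷ ps) =
    let vs , put , ch′ , ps′ = chain-insert P ft i g⊏f h ch tri pf ps in
    _ , there put , cons lt bs ch′ (↭-trans (↭-prep t p) (↭-sym (↭.↭-shift L R))) , pg ∷ ps′

  real-fractions : ∀ {s M} → Real s M → List ℝ
  real-fractions r = fractions (RealBelow.chain r)

  -- An age split into its integer and fractional parts.
  record Split (x : ℝ) : Set where
    constructor split
    field
      integer     : ℕ
      fraction    : ℝ
      sum-of      : x ≈ ι integer ∔ fraction
      fraction⊒0  : 0# ⊑ fraction
      fraction⊏1  : fraction ⊏ 1ℝ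

  real-insert : ∀ (P : ℝ → Set) a {s M p x} → Below K (proj₂ a) → Match a (p , x) →
    (r : Real s M) (sp : Split (value x)) → Tri 0# (Split.fraction sp) → All (Tri (Split.fraction sp)) (real-fractions r) →
    P (Split.fraction sp) → All P (real-fractions r) →
    ∃[ s′ ] Put a s s′ × Σ[ r′ ∈ Real s′ ((p , x) ∷ M) ] All P (real-fractions r′)
  real-insert P a {p = p} {x} bel mt (real {ints} {rest} Z C q) (split m f x≈ 0⊑f f⊏1) tri₀ tri pf ps = case tri₀
    where
    letter : Letter
    letter = p , cap m
    i : Inst f letter (p , x)
    i = inst refl m x≈ refl
    case : Tri 0# f → ∃[ s′ ] Put a _ s′ × Σ[ r′ ∈ Real s′ ((p , x) ∷ _) ] All P (real-fractions r′)
    case (inj₁ 0⊏f) =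
      let vs , put , C′ , ps′ = chain-insert P (match⇒fits a bel (0⊏f , f⊏1) i mt) i 0⊏f f⊏1 C tri pf ps in
      _ , fractional put , real Z C′ (↭-trans (↭-prep (p , x) q) (↭-sym (↭.↭-shift ints rest))) , ps′
    case (inj₂ (inj₁ 0≈f)) =
      _ , integral (match⇒fits a bel (≈-sym 0≈f) i mt) , real (inst-≈ (≈-sym 0≈f) i ∷ Z) C (↭-prep (p , x) q) , ps
    case (inj₂ (inj₂ f⊏0)) = contradiction 0⊑f (⊏-⊒-absurd f⊏0)

  split-at : ∀ {x f} m → x ≈ ι m ∔ f → ι m ⊑ x → x ⊏ ι (suc m) → Split x
  split-at {x} {f} m x≈ le lt = split m f x≈
    (∔-cancelʳ-⊑ (ι m) (begin
      0# ∔ ι m ≈⟨ ≈-trans (∔-comm 0# (ι m)) (∔-identityʳ (ι m)) ⟩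
      ι m      ≤⟨ le ⟩
      x        ≈⟨ ≈-trans x≈ (∔-comm (ι m) f) ⟩
      f ∔ ι m  ∎))
    (∔-cancelʳ-⊏ (ι m) (begin-strict
      f ∔ ι m   ≈⟨ ≈-trans (∔-comm f (ι m)) (≈-sym x≈) ⟩
      x         <⟨ lt ⟩
      ι (suc m) ≈⟨ ≈-trans (ι-suc m) (∔-comm (ι m) 1ℝ) ⟩
      1ℝ ∔ ι m  ∎))
    where open ℝ-Reasoning

  ¬¬-split : ∀ x → 0# ⊑ x → ¬ ¬ Split x
  ¬¬-split x 0⊑x = ¬¬-All (λ k → ¬¬-tri x (ι k)) (upTo (suc n)) >>= λ tris →
    let m , le , lt = floor (suc n) 0⊑x (⊑-⊏-trans x⊑n (⊏-ι-suc n)) tris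
        f , eq = x ∸ ι m
    in return (split-at m (≈-trans (≈-sym eq) (∔-comm f (ι m))) le lt)
    where
    n   = proj₁ (archimedean x)
    x⊑n = proj₂ (archimedean x)

  put-complete : ∀ a {s M t} → Below K (proj₂ a) → Match a t → Real s M → ¬ ¬ (∃[ s′ ] Put a s s′ × Real s′ (t ∷ M))
  put-complete a {t = p , x} bel mt r = ¬¬-split (value x) (0⊑value x) >>= λ sp →
    ¬¬-tri 0# (Split.fraction sp) >>= λ tri₀ →
    ¬¬-All (¬¬-tri (Split.fraction sp)) (real-fractions r) >>= λ tri →
    let s′ , put , r′ , _ = real-insert (λ _ → ⊤) a bel mt r sp tri₀ tri tt (All.tabulate λ _ → tt) in
    return (s′ , put , r′)

  puts-complete : ∀ {as s b R} → All (Below K ∘ proj₂) as → Pointwise Match as b → Real s R →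
    ¬ ¬ (∃[ s′ ] Sequence Put as s s′ × Real s′ (R ++ b))
  puts-complete {R = R} []           []        r = return (_ , [] , real-resp (↭-reflexive (List.++-identityʳ R)) r)
  puts-complete {as = a ∷ _} {b = t ∷ b} {R} (bel ∷ bels) (mt ∷ ms) r = put-complete a bel mt r >>= λ (_ , x , r′) →
    puts-complete bels ms r′ >>= λ (s′ , xs , r″) →
    return (s′ , x ∷ xs , real-resp (↭.↭-shift R b) r″)

  -- A delay of less than one unit: with h = 1 - d, the tokens of fractional
  -- part below h stay below the next integer, those at h reach it, and those
  -- above h pass it.
  short-delay : ∀ d {s M} → 0# ⊏ value d → value d ⊏ 1ℝ → Real s M → ¬ ¬ (∃[ t ] Star _⇒_ s t × Real t (ageBy N d M))
  short-delay d {s = z , ws} {M} 0⊏d d⊏1 (real {ints} {rest} Z C p) =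
    ¬¬-All (¬¬-tri h) (fractions C) >>= λ tri → return (case (chain-locate C 0⊏h tri))
    where
    h : ℝ
    h = proj₁ (1ℝ ∸ value d)
    h+d : h ∔ value d ≈ 1ℝ
    h+d = proj₂ (1ℝ ∸ value d)
    0⊏h : 0# ⊏ h
    0⊏h = ∔-cancelʳ-⊏ (value d)
      (⊑-⊏-trans (≈⇒⊑ (≈-trans (∔-comm 0# (value d)) (∔-identityʳ (value d)))) (⊏-⊑-trans d⊏1 (≈⇒⊒ h+d)))
    Reached : List Bucket → Set
    Reached ws = ∃[ t ] Star _⇒_ (z , ws) t × Real t (ageBy N d M)
    -- The bucket at g passes an integer: the delay is cut when it does.
    pass : ∀ {g us l vs U L V} → h ⊑ g → Chain 0# h us U → Pointwise (Inst g) l L → Chain g 1ℝ vs V →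
      rest ↭ U ++ L ++ V → ∃[ d₁ ] 0# ⊏ value d₁ × g ∔ value d₁ ≈ 1ℝ →
      (∀ {d₁} → g ∔ value d₁ ≈ 1ℝ → ∃[ d₂ ] 0# ⊏ value d₂ × (h ∔ value d₁) ∔ value d₂ ≈ 1ℝ) → Reached (us ++ l ∷ vs)
    pass {us = us} h⊑g below at above q (d₁ , 0⊏d₁ , g+d₁) remainder =
      let d₂ , 0⊏d₂ , h+d₁+d₂ = remainder {d₁} g+d₁ in
      _ , (_ , wrap us , refl) ◅ (_ , drift , refl) ◅ ε ,
      real-resp (ageBy-∔ d₁ d₂ d (total-delay d₁ d₂ h+d₁+d₂) M) (real-clean (elapse-drift d₂ 0⊏d₂ (≈⇒⊑ h+d₁+d₂)
        (real-clean (elapse-wrap d₁ g+d₁ h⊑g Z below at above (↭-trans p (↭.++⁺ˡ ints q))))))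
      where
      open ℝ-Reasoning
      total-delay : ∀ d₁ d₂ → (h ∔ value d₁) ∔ value d₂ ≈ 1ℝ → value d₁ ∔ value d₂ ≈ value d
      total-delay d₁ d₂ h+d₁+d₂ = ∔-cancelʳ h (begin-equality
        (value d₁ ∔ value d₂) ∔ h ≈⟨ solve⊞ 3 (λ a b h → (a ⊞ b) ⊞ h ⊜ (h ⊞ a) ⊞ b) ≈-refl (value d₁) (value d₂) h ⟩
        (h ∔ value d₁) ∔ value d₂ ≈⟨ h+d₁+d₂ ⟩
        1ℝ                        ≈⟨ h+d ⟨
        h ∔ value d               ≈⟨ ∔-comm h (value d) ⟩
        value d ∔ h               ∎)
    case : ∀ {ws} → Located 0# h rest ws → Reached ws
    case (top C′) = _ , (_ , drift , refl) ◅ ε , real-clean (elapse-drift d 0⊏d (≈⇒⊑ h+d) (real Z C′ p))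
    case (bottom us h⊑g (inj₁ h≈g) below at above q) = _ , (_ , wrap us , refl) ◅ ε ,
      real-clean (real-weaken (≈⇒⊑ h+d)
        (elapse-wrap d (≈-trans (∔-congʳ (value d) (≈-sym h≈g)) h+d) h⊑g Z below at above (↭-trans p (↭.++⁺ˡ ints q))))
    case (bottom us h⊑g (inj₂ h⊏g) below at above q) = pass h⊑g below at above q (delay-to-1 (chain-< above))
      λ {d₁} g+d₁ → delay-to-1 (⊏-⊑-trans (∔-monoˡ-⊏ (value d₁) h⊏g) (≈⇒⊑ g+d₁))

  -- By induction on an upper bound n of the delay.
  delay-complete : ∀ n d {s M} → value d ⊑ ι n → Real s M → ¬ ¬ (∃[ t ] Star _⇒_ s t × Real t (ageBy N d M))
  delay-complete n d {s} {M} d⊑n r = ¬¬-tri 0# (value d) >>= λ where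
    (inj₂ (inj₂ d⊏0)) → contradiction (0⊑value d) (⊏-⊒-absurd d⊏0)
    (inj₂ (inj₁ 0≈d)) → return (s , ε , real-resp (ageBy-zero d (≈-sym 0≈d) M) r)
    (inj₁ 0⊏d) → ¬¬-tri (value d) 1ℝ >>= λ where
      (inj₁ d⊏1)        → short-delay d 0⊏d d⊏1 r
      (inj₂ (inj₁ d≈1)) → long n d⊑n (≈⇒⊒ d≈1)
      (inj₂ (inj₂ 1⊏d)) → long n d⊑n (⊏⇒⊑ 1⊏d)
   where
    long : ∀ n → value d ⊑ ι n → 1ℝ ⊑ value d → ¬ ¬ (∃[ t ] Star _⇒_ s t × Real t (ageBy N d M))
    long zero    d⊑n 1⊑d = contradiction (⊑-trans 1⊑d (⊑-trans d⊑n (≈⇒⊑ (≈-reflexive ι-zero)))) (⊏-⊒-absurd 0⊏1)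
    long (suc n) d⊑n 1⊑d = delay-complete n d′ e⊑n (real-clean (elapse-unit unit-delay ≈-refl r)) >>= λ (t , sts , r′) →
      return (t , (_ , unit , refl) ◅ sts , real-resp (ageBy-∔ unit-delay d′ d (≈-trans (∔-comm 1ℝ e) e+1) M) r′)
      where
      e : ℝ
      e = proj₁ (value d ∸ 1ℝ)
      e+1 : e ∔ 1ℝ ≈ value d
      e+1 = proj₂ (value d ∸ 1ℝ)
      0⊑e : 0# ⊑ e
      0⊑e = ∔-cancelʳ-⊑ 1ℝ (⊑-trans (≈⇒⊑ (≈-trans (∔-comm 0# 1ℝ) (∔-identityʳ 1ℝ))) (⊑-trans 1⊑d (≈⇒⊒ e+1)))
      e⊑n : e ⊑ ι n
      e⊑n = ∔-cancelʳ-⊑ 1ℝ (⊑-trans (≈⇒⊑ e+1) (⊑-trans d⊑n (≈⇒⊑ (ι-suc n))))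
      d′ : ℝ≥0
      d′ = e , toℝ≥0 e 0⊑e

  step-complete : ∀ {s M M′} → Real s M → Step N M M′ → ¬ ¬ (∃[ t ] Star _⇒_ s t × Real t M′)
  step-complete r (inj₁ (d , _ , p)) = let n , d⊑n = archimedean (value d) in
    delay-complete n d d⊑n r >>= λ (t , sts , r′) → return (t , sts , real-resp p r′)
  step-complete r (inj₂ (τ , b₁ , b₂ , R , ms , ms′ , p , q)) =
    let _ , takes , r′ = takes-complete (inBelow τ) r ms p in
    puts-complete (outBelow τ) ms′ r′ >>= λ (_ , puts , r″) →
    return (_ , (_ , fire τ takes puts , refl) ◅ ε , real-clean (real-resp q r″))

  reach-complete : ∀ {s M M′} → Real s M → Reach N M M′ → ¬ ¬ (∃[ t ] Star _⇒_ s t × Real t M′)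
  reach-complete r ε            = return (_ , ε , r)
  reach-complete r (st ◅ steps) = step-complete r st >>= λ (_ , sts , r′) →
    reach-complete r′ steps >>= λ (t , sts′ , r″) → return (t , sts ◅◅ sts′ , r″)

  ----------------------------------------------------------------------
  -- The state of a rational marking

  -- The real is given by a rational, not merely equal to one.
  Rational : ℝ → Set
  Rational f = ∃[ q ] f ≡ κ q

  tri-rational : ∀ {f g} → Rational f → Rational g → Tri f g
  tri-rational (p , refl) (q , refl) = tri-ℚ p q

  ι-rational : ∀ n → Rational (ι n)
  ι-rational n = _ , ι≡κ n

  -- Ages are compared exactly here, so that the state is computed.
  rational-split : ∀ {x} q → x ≈ κ q → 0# ⊑ x → Σ[ sp ∈ Split x ] Rational (Split.fraction sp)
  rational-split {x} q x≈q 0⊑x = at floored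
    where
    n : ℕ
    n = proj₁ (archimedean (κ q))
    floored : ∃[ m ] ι m ⊑ κ q × κ q ⊏ ι (suc m)
    floored = floor (suc n) (⊑-trans 0⊑x (≈⇒⊑ x≈q)) (⊑-⊏-trans (proj₂ (archimedean (κ q))) (⊏-ι-suc n))
      (All.tabulate λ {k} _ → tri-rational (q , refl) (ι-rational k))
    difference : ∀ m → q ≡ m ℚ.+ (q ℚ.- m)
    difference m = solve 2 (λ m q → q := m :+ (q :- m)) refl m q
      where open +-*-Solver
    at : ∃[ m ] ι m ⊑ κ q × κ q ⊏ ι (suc m) → Σ[ sp ∈ Split x ] Rational (Split.fraction sp)
    at (m , le , lt) = split-at m (begin-equality
      x                       ≈⟨ x≈q ⟩
      κ q                     ≡⟨ cong κ (difference m′) ⟩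
      κ (m′ ℚ.+ (q ℚ.- m′))   ≈⟨ κ-∔ m′ (q ℚ.- m′) ⟩
      κ m′ ∔ κ (q ℚ.- m′)     ≡⟨ cong (_∔ κ (q ℚ.- m′)) (ι≡κ m) ⟨
      ι m ∔ κ (q ℚ.- m′)      ∎)
      (⊑-trans le (≈⇒⊒ x≈q)) (⊑-⊏-trans (≈⇒⊑ x≈q) lt) , q ℚ.- m′ , refl
      where
      open ℝ-Reasoning
      m′ : ℚ
      m′ = + m ℚ./ 1

  -- A state realised by the marking, with rational fractional parts.
  InitialState : RationalMarking N → Set
  InitialState ts = ∃[ s ] Σ[ r ∈ Real s (fromRational N ts) ] All Rational (real-fractions r)

  -- Tokens are inserted one by one, by way of an arc that any token may be
  -- moved along; its constant 0 has to be below K.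
  initial : 0 ℕ.< K → ∀ ts → InitialState ts
  initial 0<K []             = ([] , []) , real [] (end 0⊏1 ↭-refl) ↭-refl , []
  initial 0<K ((p , q) ∷ ts) =
    insert (initial 0<K ts) (rational-split (proj₁ q) (value-fromℚ≥0 q) (0⊑value (fromℚ≥0 q)))
    where
    everywhere : Arc
    everywhere = p , record { lower = closed 0 ; upper = ∞ }
    everywhere-match : Match everywhere (p , fromℚ≥0 q)
    everywhere-match = refl , proj₂ (ι⊑⇔ 0 (value (fromℚ≥0 q))) (⊑-trans (≈⇒⊑ (≈-reflexive ι-zero)) (0⊑value (fromℚ≥0 q))) , tt
    insert : InitialState ts → Σ[ sp ∈ Split (value (fromℚ≥0 q)) ] Rational (Split.fraction sp) → InitialState ((p , q) ∷ ts)
    insert (s , r , rational) (sp , rational-f) =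
      let s′ , _ , r′ , rational′ = real-insert Rational everywhere (0<K , tt) everywhere-match r sp
            (tri-rational (0ℚ , refl) rational-f) (All.map (tri-rational rational-f) rational) rational-f rational
      in s′ , r′ , rational′

------------------------------------------------------------------------
-- A bound on the constants of a net

below-mono : ∀ {K K′} I → K ℕ.≤ K′ → Below K I → Below K′ I
below-mono {K} {K′} I K≤K′ (l , u) = lower (Interval.lower I) l , upper (Interval.upper I) u
  where
  lower : ∀ L → LowerBelow K L → LowerBelow K′ L
  lower (closed _) p = ℕ.≤-trans p K≤K′
  lower (strict _) p = ℕ.≤-trans p K≤K′
  upper : ∀ U → UpperBelow K U → UpperBelow K′ U
  upper (closed _) p = ℕ.≤-trans p K≤K′
  upper (strict _) p = ℕ.≤-trans p K≤K′
  upper ∞          _ = tt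

below-exists : ∀ {A : Set} (as : List (A × Interval)) → ∃[ K ] 0 ℕ.< K × All (Below K ∘ proj₂) as
below-exists []             = 1 , s≤s z≤n , []
below-exists ((_ , I) ∷ as) =
  let K , 0<K , bels = below-exists as; K′ = lower (Interval.lower I) ℕ.+ upper (Interval.upper I) ℕ.+ K in
  K′ , ℕ.≤-trans 0<K (ℕ.m≤n+m K _) ,
  (below-lower (Interval.lower I) (ℕ.≤-trans (ℕ.m≤m+n _ _) (ℕ.m≤m+n _ K)) ,
   below-upper (Interval.upper I) (ℕ.≤-trans (ℕ.m≤n+m _ (lower (Interval.lower I))) (ℕ.m≤m+n _ K))) ∷
  All.map (λ {(_ , J)} → below-mono J (ℕ.m≤n+m K _)) bels
  where
  lower : LowerBound → ℕ
  lower (closed a) = suc a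
  lower (strict a) = suc a
  upper : UpperBound → ℕ
  upper (closed b) = suc b
  upper (strict b) = suc b
  upper ∞          = 0
  below-lower : ∀ L {k} → lower L ℕ.≤ k → LowerBelow k L
  below-lower (closed _) p = p
  below-lower (strict _) p = p
  below-upper : ∀ U {k} → upper U ℕ.≤ k → UpperBelow k U
  below-upper (closed _) p = p
  below-upper (strict _) p = p
  below-upper ∞          _ = tt

below-net : ∀ N → ∃[ K ] 0 ℕ.< K
  × (∀ τ → All (Below K ∘ proj₂) (arcs N (TPN.In N τ))) × (∀ τ → All (Below K ∘ proj₂) (arcs N (TPN.Out N τ)))
below-net N with below-exists (concatMap (λ τ → arcs N (TPN.In N τ) ++ arcs N (TPN.Out N τ)) (allFin _))
... | K , 0<K , bels = K , 0<K , (λ τ → All.++⁻ˡ (arcs N (TPN.In N τ)) (at τ)) , (λ τ → All.++⁻ʳ (arcs N (TPN.In N τ)) (at τ))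
  where
  at : ∀ τ → All (Below K ∘ proj₂) (arcs N (TPN.In N τ) ++ arcs N (TPN.Out N τ))
  at τ = All.lookup (All.map⁻ (All.concat⁻ bels)) (Mem.∈-allFin τ)

------------------------------------------------------------------------
-- Decidability

module Decision (N : TPN) (M₀ : RationalMarking N) (K : ℕ) (0<K : 0 ℕ.< K)
  (inBelow  : ∀ τ → All (Below K ∘ proj₂) (arcs N (TPN.In N τ)))
  (outBelow : ∀ τ → All (Below K ∘ proj₂) (arcs N (TPN.Out N τ)))
  where
  open Regions N K
  open Realisation N K
  open Simulation N K inBelow outBelow

  decide-from : ∀ s → Real s (fromRational N M₀) → Clean s → Dec (SyntacticallyBounded N (fromRational N M₀))
  decide-from s r cl = decide pump-or-bounded
    where
    open Exploration _≟ₛ_ successors size ≼-af Clean ⇒-Clean ≼-size s cl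

    decide : Pump ⊎ ∃[ c ] (∀ {t} → Star _⇒_ s t → size t ℕ.≤ c) →
      Dec (SyntacticallyBounded N (fromRational N M₀))
    decide (inj₁ pump) = no λ (c , bound) →
      let u , sts , c<u = pump-unbounded ⇒-simulate pump (suc c)
          M , steps , rᵤ = ⇒⋆-sound r sts
      in ℕ.<⇒≱ c<u (subst (ℕ._≤ c) (real-size rᵤ) (bound M steps))
    decide (inj₂ (c , bound)) = yes (c , λ M steps →
      Dec.decidable-stable (length M ℕ.≤? c) (reach-complete r steps >>= λ (t , sts , rₜ) →
        return (subst (ℕ._≤ c) (sym (real-size rₜ)) (bound sts))))

  decision : Dec (SyntacticallyBounded N (fromRational N M₀))
  decision = let s , r , _ = initial 0<K M₀ in decide-from (clean s) (real-clean r) (clean-Clean s)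

theorem8p2 : (N : TPN) (M₀ : RationalMarking N) → Dec (SyntacticallyBounded N (fromRational N M₀))
theorem8p2 N M₀ = let K , 0<K , inBelow , outBelow = below-net N in Decision.decision N M₀ K 0<K inBelow outBelow
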